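{- There exist absolute constants $c_*>0$ and $K>0$ such that for every finite abelian group $\mathbf{G}$ of order $N$, the number $T(\mathbf{G})$ of ordered triples $(A,B,C)$ of subsets of $\mathbf{G}$ such that $x+y\neq z$ for all $x\in A$, $y\in B$, $z\in C$ satisfies $$\bigl|T(\mathbf{G})-3\cdot 4^N-3N\cdot 3^N\bigr|\leqslant K(3-c_*)^N .$$
   Context: The subsets $A,B,C$ may be empty. -}

module Defs where

open import Algebra.Bundles using (AbelianGroup)
import Algebra.Definitions.RawSemiring as RawSemiringDefinitions
open import Data.Empty using (⊥)
open import Data.Fin.Base using (Fin)
open import Data.Fin.Properties using (all?; _≟_)
open import Data.Fin.Subset using (Subset; inside; outside; _∈_)
open import Data.Fin.Subset.Properties using (_∈?_)
open import Data.List.Base using (List; []; _∷_; _++_; map; filter; length; cartesianProduct)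
import Data.List.Membership.Propositional as List
open import Data.List.Membership.Propositional.Properties using (∈-map⁺; ∈-map⁻; ∈-++⁺ˡ; ∈-++⁺ʳ)
open import Data.List.Relation.Unary.All using ([])
open import Data.List.Relation.Unary.AllPairs using ([]; _∷_)
open import Data.List.Relation.Unary.Any using (here)
open import Data.List.Relation.Unary.Unique.Propositional using (Unique)
import Data.List.Relation.Unary.Unique.Propositional.Properties as Unique
open import Data.Nat.Base using (ℕ; zero; suc)
open import Data.Product.Base using (∃; _×_; _,_)
open import Data.Rational.Base using (+-*-rawSemiring)
open import Data.Vec.Base using ([]; _∷_)
open import Data.Vec.Properties using (∷-injectiveʳ)
open import Function.Bundles using (Inverse)
open import Level using (Level; _⊔_)
open import Relation.Binary.PropositionalEquality using (_≡_; refl; sym; subst; setoid)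
open import Relation.Nullary using (Dec; ¬_; ¬?; _→-dec_)
open import Relation.Nullary.Decidable using (map′)

-- Real constants c, K > 0 are replaced by rational ones. Nothing is lost: the
-- trivial group has 7 sum-avoiding triples, so 14 ≤ K (3 - c) and hence c < 3,
-- and then decreasing c and increasing K to rationals weakens the bound.
open RawSemiringDefinitions +-*-rawSemiring public using () renaming (_^_ to _^ℚ_)

allSubsets : ∀ n → List (Subset n)
allSubsets zero    = [] ∷ []
allSubsets (suc n) = map (inside ∷_) (allSubsets n) ++ map (outside ∷_) (allSubsets n)

allSubsets-complete : ∀ {n} (A : Subset n) → A List.∈ allSubsets n
allSubsets-complete []            = here refl
allSubsets-complete (inside ∷ A)  = ∈-++⁺ˡ (∈-map⁺ (inside ∷_) (allSubsets-complete A))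
allSubsets-complete (outside ∷ A) =
  ∈-++⁺ʳ (map (inside ∷_) (allSubsets _)) (∈-map⁺ (outside ∷_) (allSubsets-complete A))

allSubsets-unique : ∀ n → Unique (allSubsets n)
allSubsets-unique zero    = [] ∷ []
allSubsets-unique (suc n) =
  Unique.++⁺ (Unique.map⁺ ∷-injectiveʳ (allSubsets-unique n))
             (Unique.map⁺ ∷-injectiveʳ (allSubsets-unique n))
             λ (p , q) → disjoint (∈-map⁻ (inside ∷_) p) (∈-map⁻ (outside ∷_) q)
  where
  disjoint : ∀ {v : Subset (suc n)} →
             ∃ (λ A → A List.∈ allSubsets n × v ≡ inside ∷ A) →
             ∃ (λ A → A List.∈ allSubsets n × v ≡ outside ∷ A) → ⊥
  disjoint (_ , _ , refl) (_ , _ , ())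

-- The group has order N. An identification with Fin N (rather than a bare
-- cardinality) is kept because a subset of the group is represented by the
-- Subset N of the indices of its elements.
HasOrder : ∀ {a ℓ} → AbelianGroup a ℓ → ℕ → Set (a ⊔ ℓ)
HasOrder G N = Inverse (AbelianGroup.setoid G) (setoid (Fin N))

module _ {a ℓ : Level} (G : AbelianGroup a ℓ) {N : ℕ} (index : HasOrder G N) where
  open AbelianGroup G using (Carrier; _≈_; _∙_; ∙-cong)
    renaming (sym to ≈-sym; trans to ≈-trans)
  open Inverse index using (to; from; to-cong; from-cong; strictlyInverseˡ; strictlyInverseʳ)

  Member : Carrier → Subset N → Set
  Member x A = to x ∈ A

  SumAvoiding : Subset N × Subset N × Subset N → Set (a ⊔ ℓ)
  SumAvoiding (A , B , C) =
    ∀ x y z → Member x A → Member y B → Member z C → ¬ (x ∙ y ≈ z)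

  sumAvoiding? : ∀ t → Dec (SumAvoiding t)
  sumAvoiding? (A , B , C) = map′ fromIndices toIndices
    (all? λ i → all? λ j → all? λ k →
      (i ∈? A) →-dec ((j ∈? B) →-dec ((k ∈? C) →-dec ¬? (to (from i ∙ from j) ≟ k))))
    where
    OnIndices : Set
    OnIndices = ∀ i j k → i ∈ A → j ∈ B → k ∈ C → ¬ (to (from i ∙ from j) ≡ k)

    fromIndices : OnIndices → SumAvoiding (A , B , C)
    fromIndices h x y z x∈A y∈B z∈C xy≈z = h (to x) (to y) (to z) x∈A y∈B z∈C
      (to-cong (≈-trans (∙-cong (strictlyInverseʳ x) (strictlyInverseʳ y)) xy≈z))

    toIndices : SumAvoiding (A , B , C) → OnIndices
    toIndices h i j k i∈A j∈B k∈C eq = h (from i) (from j) (from k)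
      (subst (_∈ A) (sym (strictlyInverseˡ i)) i∈A)
      (subst (_∈ B) (sym (strictlyInverseˡ j)) j∈B)
      (subst (_∈ C) (sym (strictlyInverseˡ k)) k∈C)
      (≈-trans (≈-sym (strictlyInverseʳ _)) (from-cong eq))

  numSumAvoiding : ℕ
  numSumAvoiding = length (filter sumAvoiding?
    (cartesianProduct (allSubsets N) (cartesianProduct (allSubsets N) (allSubsets N))))

{-# OPTIONS --safe #-}

-- Triples with some set of size at most 1 contribute the main term: if A is empty
-- there are 4^N pairs (B, C), and if A is a singleton there are 3^N. It remains to
-- bound the triples whose three sets all have at least two elements.
--
-- For |A| = k, the pairs (B, C) that avoid A are the independent sets of a k-regular
-- bipartite graph on N + N vertices. Finner's inequality (Hölder applied to one element
-- of B at a time) gives at most 2^((k+1)N/k) of them. For k = 2 this is √8^N, which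
-- settles the triples with a set of size between 2 and 32, since there are few such sets.
-- If all sizes exceed 32, then each of the three projections, say to (A, B), has at most
-- 2^(33N/32) elements for each 32-element subset of the third set, and the
-- Loomis–Whitney inequality bounds the number of triples by about 2^(99N/64) < 3^N.

module Submission where

open import Defs
open import Algebra.Bundles using (AbelianGroup; CommutativeMonoid)
import Algebra.Properties.CommutativeMonoid.Sum as CommutativeMonoidSum
import Algebra.Properties.CommutativeSemigroup as CommutativeSemigroupProperties
import Algebra.Properties.Group as GroupProperties
open import Data.Bool.Base using (Bool; true; false; not; _∧_; if_then_else_; T)
open import Data.Bool.Properties using (T-≡; ¬-not)
open import Data.Fin.Base using (Fin; zero; suc)
open import Data.Fin.Permutation using (Permutation′; permutation)
open import Data.Fin.Properties using (all?; _≟_)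
open import Data.Fin.Subset using (Subset; inside; outside; ∣_∣; _∈_; _∉_; _⊆_; ⊥; ⁅_⁆)
open import Data.Fin.Subset.Properties using (_∈?_; x∈⁅x⁆; x∈⁅y⁆⇒x≡y; ∉⊥; ⊆-refl; out⊆; in⊆in)
open import Data.Integer.Base as ℤ using (ℤ; +_)
import Data.Integer.Properties as ℤ
open import Data.List.Base as List using ([]; _∷_; map; filter; length; cartesianProduct)
open import Data.List.Properties using (map-++; map-∘)
open import Data.Nat.Base as ℕ hiding (_/_)
open import Data.Nat.Coprimality using (1-coprimeTo) renaming (sym to coprime-sym)
open import Data.Nat.ListAction renaming (sum to ∑ᴸ)
open import Data.Nat.ListAction.Properties using (sum-++)
open import Data.Nat.Properties hiding (_≟_)
open import Data.Nat.Tactic.RingSolver using (solve-∀)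
open import Data.Product.Base using (_×_; _,_; ∃-syntax)
open import Data.Rational.Base as ℚ using (ℚ; 0ℚ; _/_; mkℚ; *≤*)
import Data.Rational.Properties as ℚ
open import Data.Sum.Base using (_⊎_; inj₁; inj₂)
open import Data.Vec.Base using ([]; _∷_; lookup; tabulate; head; tail; here; there)
open import Data.Vec.Properties using (lookup∘tabulate; []=⇒lookup; lookup⇒[]=)
open import Function.Base using (_∘_)
open import Function.Bundles using (Equivalence; Inverse)
open import Relation.Binary.PropositionalEquality
open import Relation.Nullary using (Dec; does; yes; no; ¬_; ¬?; _→-dec_; contradiction)
open import Relation.Nullary.Decidable using (dec-true; dec-false)
open import Relation.Unary using (Pred; Decidable)

open CommutativeMonoidSum +-0-commutativeMonoid using (sum; sum-cong-≗; sum-permute)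
open CommutativeMonoidSum *-1-commutativeMonoid using ()
  renaming (sum to ∏; sum-cong-≗ to ∏-cong; sum-permute to ∏-permute)

-- Weighted AM-GM in the natural numbers.

^-distribʳ-* : ∀ m n o → (m * n) ^ o ≡ m ^ o * n ^ o
^-distribʳ-* m n zero    = refl
^-distribʳ-* m n (suc o) = trans (cong (m * n *_) (^-distribʳ-* m n o)) (lemma m n (m ^ o) (n ^ o))
  where
  lemma : ∀ m n p q → m * n * (p * q) ≡ m * p * (n * q)
  lemma = solve-∀

rearrangement-≤ : ∀ {x y p q} → x ≤ y → p ≤ q → x * q + y * p ≤ x * p + y * q
rearrangement-≤ {x} {y} {p} {q} x≤y p≤q = begin
  x * q + y * p                ≡⟨ cong (λ y → x * q + y * p) (m+[n∸m]≡n x≤y) ⟨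
  x * q + (x + d) * p          ≡⟨ lemma₁ x d p q ⟩
  x * q + x * p + d * p        ≤⟨ +-monoʳ-≤ (x * q + x * p) (*-monoʳ-≤ d p≤q) ⟩
  x * q + x * p + d * q        ≡⟨ lemma₂ x d p q ⟩
  x * p + (x + d) * q          ≡⟨ cong (λ y → x * p + y * q) (m+[n∸m]≡n x≤y) ⟩
  x * p + y * q                ∎
  where
  open ≤-Reasoning
  d = y ∸ x
  lemma₁ : ∀ x d p q → x * q + (x + d) * p ≡ x * q + x * p + d * p
  lemma₁ = solve-∀
  lemma₂ : ∀ x d p q → x * q + x * p + d * q ≡ x * p + (x + d) * q
  lemma₂ = solve-∀

rearrangement-^ : ∀ u w n → u * w ^ n + w * u ^ n ≤ u ^ suc n + w ^ suc n
rearrangement-^ u w n with ≤-total u w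
... | inj₁ u≤w = rearrangement-≤ u≤w (^-monoˡ-≤ n u≤w)
... | inj₂ w≤u = subst₂ _≤_ (+-comm (w * u ^ n) _) (+-comm (w ^ suc n) _)
                   (rearrangement-≤ w≤u (^-monoˡ-≤ n w≤u))

-- The convex function `w ^ suc n` lies above its tangent at `u`. In the induction the previous case
-- is multiplied by `u`, and `rearrangement-^` absorbs the mixed terms.
young : ∀ n u w → suc n * u ^ n * w ≤ w ^ suc n + n * u ^ suc n
young zero    u w = ≤-reflexive (lemma w)
  where
  lemma : ∀ w → 1 * 1 * w ≡ w * 1 + 0
  lemma = solve-∀
young (suc n) u w = begin
  suc (suc n) * u ^ suc n * w                             ≡⟨ lemma₁ n u (u ^ n) w ⟩
  u * (suc n * u ^ n * w) + u ^ suc n * w                 ≤⟨ +-monoˡ-≤ _ (*-monoʳ-≤ u (young n u w)) ⟩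
  u * (w ^ suc n + n * u ^ suc n) + u ^ suc n * w         ≡⟨ lemma₂ n u (u ^ suc n) (w ^ suc n) w ⟩
  (u * w ^ suc n + w * u ^ suc n) + n * (u * u ^ suc n)   ≤⟨ +-monoˡ-≤ _ (rearrangement-^ u w (suc n)) ⟩
  (u * u ^ suc n + w ^ suc (suc n)) + n * (u * u ^ suc n) ≡⟨ lemma₃ n (u * u ^ suc n) (w ^ suc (suc n)) ⟩
  w ^ suc (suc n) + suc n * u ^ suc (suc n)               ∎
  where
  open ≤-Reasoning
  lemma₁ : ∀ n u v w → suc (suc n) * (u * v) * w ≡ u * (suc n * v * w) + u * v * w
  lemma₁ = solve-∀
  lemma₂ : ∀ n u v z w → u * (z + n * v) + v * w ≡ (u * z + w * v) + n * (u * v)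
  lemma₂ = solve-∀
  lemma₃ : ∀ n a b → (a + b) + n * a ≡ b + suc n * a
  lemma₃ = solve-∀

-- AM-GM for `n` copies of `s / n` and one `t`, with denominators cleared. It is `young` at
-- `u = s * suc n` and `w = n * (s + t)`; the term `X` is added to both sides to avoid a
-- subtraction.
amgm-step : ∀ n s t → suc n ^ suc n * (s ^ n * t) ≤ n ^ n * (s + t) ^ suc n
amgm-step zero      s t = subst₂ _≤_ (lemma₁ t) (lemma₂ (s + t)) (m≤n+m t s)
  where
  lemma₁ : ∀ t → t ≡ 1 * (1 * t)
  lemma₁ = solve-∀
  lemma₂ : ∀ t → t ≡ 1 * (t * 1)
  lemma₂ = solve-∀
amgm-step n@(suc _) s t = *-cancelˡ-≤ n (+-cancelˡ-≤ X _ _ (begin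
  X + n * (suc n ^ suc n * (s ^ n * t))                 ≡⟨ lemma₁ n s t (suc n ^ n) (s ^ n) ⟩
  suc n * (s ^ n * suc n ^ n) * (n * (s + t))           ≡⟨ cong (λ z → suc n * z * (n * (s + t))) (^-distribʳ-* s (suc n) n) ⟨
  suc n * (s * suc n) ^ n * (n * (s + t))               ≤⟨ young n (s * suc n) (n * (s + t)) ⟩
  (n * (s + t)) ^ suc n + n * (s * suc n) ^ suc n       ≡⟨ cong₂ (λ y z → y + n * z) (^-distribʳ-* n (s + t) (suc n)) (^-distribʳ-* s (suc n) (suc n)) ⟩
  n ^ suc n * (s + t) ^ suc n + X                       ≡⟨ lemma₂ n (n ^ n) ((s + t) ^ suc n) X ⟩
  X + n * (n ^ n * (s + t) ^ suc n)                     ∎))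
  where
  open ≤-Reasoning
  X = n * (s ^ suc n * suc n ^ suc n)
  lemma₁ : ∀ n s t e v → n * (s * v * (suc n * e)) + n * (suc n * e * (v * t)) ≡ suc n * (v * e) * (n * (s + t))
  lemma₁ = solve-∀
  lemma₂ : ∀ n z y x → n * z * y + x ≡ x + n * (z * y)
  lemma₂ = solve-∀

n^n≢0 : ∀ n → NonZero (n ^ n)
n^n≢0 zero      = _
n^n≢0 n@(suc _) = m^n≢0 n n

-- Induction on the number of copies of `p`: `amgm-step` joins one more copy to the sum `s` of the
-- others.
weighted-amgm : ∀ x y p q → (x + y) ^ (x + y) * (p ^ x * q ^ y) ≤ (x * p + y * q) ^ (x + y)
weighted-amgm zero    y p q = ≤-reflexive (trans (cong (y ^ y *_) (*-identityˡ (q ^ y))) (sym (^-distribʳ-* y q y)))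
weighted-amgm (suc x) y p q = *-cancelˡ-≤ (n ^ n) {{n^n≢0 n}} (begin
  n ^ n * (suc n ^ suc n * (p * p ^ x * q ^ y))     ≡⟨ lemma₁ (n ^ n) (suc n ^ suc n) p (p ^ x) (q ^ y) ⟩
  suc n ^ suc n * (n ^ n * (p ^ x * q ^ y) * p)     ≤⟨ *-monoʳ-≤ (suc n ^ suc n) (*-monoˡ-≤ p (weighted-amgm x y p q)) ⟩
  suc n ^ suc n * (s ^ n * p)                       ≤⟨ amgm-step n s p ⟩
  n ^ n * (s + p) ^ suc n                           ≡⟨ cong (λ z → n ^ n * z ^ suc n) (lemma₂ x y p q) ⟩
  n ^ n * (suc x * p + y * q) ^ suc n               ∎)
  where
  open ≤-Reasoning
  n = x + y
  s = x * p + y * q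
  lemma₁ : ∀ a b p u v → a * (b * (p * u * v)) ≡ b * (a * (u * v) * p)
  lemma₁ = solve-∀
  lemma₂ : ∀ x y p q → x * p + y * q + p ≡ suc x * p + y * q
  lemma₂ = solve-∀

-- Entropy bound and Hölder's inequality.

-- For a fixed sum `a + b`, the product `a ^ x * b ^ y` is largest when `a : b = x : y`. Apply
-- `weighted-amgm` to `a * y` and `b * x`, whose weighted sum is `(a + b) * (x * y)`. The cases with
-- a zero exponent are separate because the cancelled factor `x ^ y * y ^ x` may vanish there.
entropy-bound : ∀ x y a b → (x + y) ^ (x + y) * (a ^ x * b ^ y) ≤ (a + b) ^ (x + y) * (x ^ x * y ^ y)
entropy-bound zero y a b = begin
  y ^ y * (1 * b ^ y)         ≡⟨ *-comm (y ^ y) _ ⟩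
  1 * b ^ y * y ^ y           ≡⟨ cong₂ _*_ (*-identityˡ (b ^ y)) (sym (*-identityˡ (y ^ y))) ⟩
  b ^ y * (1 * y ^ y)         ≤⟨ *-monoˡ-≤ (1 * y ^ y) (^-monoˡ-≤ y (m≤n+m b a)) ⟩
  (a + b) ^ y * (1 * y ^ y)   ∎
  where open ≤-Reasoning
entropy-bound x@(suc _) zero a b = subst (λ n → n ^ n * (a ^ x * 1) ≤ (a + b) ^ n * (x ^ x * 1)) (sym (+-identityʳ x)) (begin
  x ^ x * (a ^ x * 1)         ≡⟨ lemma (x ^ x) (a ^ x) ⟩
  a ^ x * (x ^ x * 1)         ≤⟨ *-monoˡ-≤ (x ^ x * 1) (^-monoˡ-≤ x (m≤m+n a b)) ⟩
  (a + b) ^ x * (x ^ x * 1)   ∎)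
  where
  open ≤-Reasoning
  lemma : ∀ u v → u * (v * 1) ≡ v * (u * 1)
  lemma = solve-∀
entropy-bound x@(suc _) y@(suc _) a b = *-cancelˡ-≤ w {{m*n≢0 (x ^ y) (y ^ x) {{m^n≢0 x y}} {{m^n≢0 y x}}}} (begin
  w * (n ^ n * (a ^ x * b ^ y))                     ≡⟨ lemma₁ (x ^ y) (y ^ x) (n ^ n) (a ^ x) (b ^ y) ⟩
  n ^ n * (a ^ x * y ^ x * (b ^ y * x ^ y))         ≡⟨ cong₂ (λ u v → n ^ n * (u * v)) (^-distribʳ-* a y x) (^-distribʳ-* b x y) ⟨
  n ^ n * ((a * y) ^ x * (b * x) ^ y)               ≤⟨ weighted-amgm x y (a * y) (b * x) ⟩
  (x * (a * y) + y * (b * x)) ^ n                   ≡⟨ cong (_^ n) (lemma₂ x y a b) ⟩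
  ((a + b) * (x * y)) ^ n                           ≡⟨ ^-distribʳ-* (a + b) (x * y) n ⟩
  (a + b) ^ n * (x * y) ^ n                         ≡⟨ cong ((a + b) ^ n *_) (^-distribʳ-* x y n) ⟩
  (a + b) ^ n * (x ^ n * y ^ n)                     ≡⟨ cong₂ (λ u v → (a + b) ^ n * (u * v)) (^-distribˡ-+-* x x y) (^-distribˡ-+-* y x y) ⟩
  (a + b) ^ n * (x ^ x * x ^ y * (y ^ x * y ^ y))   ≡⟨ lemma₃ ((a + b) ^ n) (x ^ x) (x ^ y) (y ^ x) (y ^ y) ⟩
  w * ((a + b) ^ n * (x ^ x * y ^ y))               ∎)
  where
  open ≤-Reasoning
  n = x + y
  w = x ^ y * y ^ x
  lemma₁ : ∀ p q n a b → p * q * (n * (a * b)) ≡ n * (a * q * (b * p))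
  lemma₁ = solve-∀
  lemma₂ : ∀ x y a b → x * (a * y) + y * (b * x) ≡ (a + b) * (x * y)
  lemma₂ = solve-∀
  lemma₃ : ∀ s a b c d → s * (a * b * (c * d)) ≡ b * c * (s * (a * d))
  lemma₃ = solve-∀

⟦_⟧ : Bool → ℕ
⟦ b ⟧ = if b then 1 else 0

-- Coordinates marked by `J` contribute one instance of `entropy-bound` each; every other coordinate
-- contributes the factor `s j ^ (x + y)` to both sides.
entropy-bound-∏ : ∀ x y {m} (a b s : Fin m → ℕ) (J : Fin m → Bool) →
  (∀ j → J j ≡ true → s j ≡ a j + b j) → (∀ j → J j ≡ false → a j ≡ s j) → (∀ j → J j ≡ false → b j ≡ s j) →
  ((x + y) ^ (x + y)) ^ sum (⟦_⟧ ∘ J) * (∏ a ^ x * ∏ b ^ y) ≤ ∏ s ^ (x + y) * (x ^ x * y ^ y) ^ sum (⟦_⟧ ∘ J)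
entropy-bound-∏ x y {zero} a b s J _ _ _ rewrite ^-zeroˡ x | ^-zeroˡ y | ^-zeroˡ (x + y) = ≤-refl
entropy-bound-∏ x y {suc m} a b s J flagged a≡s b≡s = split
  where
  open ≤-Reasoning
  A = ∏ (a ∘ suc)
  B = ∏ (b ∘ suc)
  S = ∏ (s ∘ suc)
  a₀ = a zero
  b₀ = b zero
  s₀ = s zero
  k = sum (⟦_⟧ ∘ J ∘ suc)
  n = x + y
  N = (n ^ n) ^ k
  E = x ^ x * y ^ y
  lemma₁ : ∀ N p q u v → N * (p * u * (q * v)) ≡ (p * q) * (N * (u * v))
  lemma₁ = solve-∀
  lemma₂ : ∀ M N p q u v → M * N * (p * u * (q * v)) ≡ (M * (p * q)) * (N * (u * v))
  lemma₂ = solve-∀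
  lemma₃ : ∀ t e u v → t * e * (u * v) ≡ t * u * (e * v)
  lemma₃ = solve-∀
  IH = entropy-bound-∏ x y (a ∘ suc) (b ∘ suc) (s ∘ suc) (J ∘ suc) (flagged ∘ suc) (a≡s ∘ suc) (b≡s ∘ suc)
  split : (n ^ n) ^ (⟦ J zero ⟧ + k) * ((a₀ * A) ^ x * (b₀ * B) ^ y) ≤ (s₀ * S) ^ n * E ^ (⟦ J zero ⟧ + k)
  split rewrite ^-distribʳ-* a₀ A x | ^-distribʳ-* b₀ B y | ^-distribʳ-* s₀ S n
    with J zero in eq
  ... | true  = begin
    n ^ n * N * (a₀ ^ x * A ^ x * (b₀ ^ y * B ^ y))       ≡⟨ lemma₂ (n ^ n) N (a₀ ^ x) (b₀ ^ y) (A ^ x) (B ^ y) ⟩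
    n ^ n * (a₀ ^ x * b₀ ^ y) * (N * (A ^ x * B ^ y))     ≤⟨ *-mono-≤ (entropy-bound x y a₀ b₀) IH ⟩
    (a₀ + b₀) ^ n * E * (S ^ n * E ^ k)                   ≡⟨ cong (λ s → s ^ n * E * (S ^ n * E ^ k)) (flagged zero eq) ⟨
    s₀ ^ n * E * (S ^ n * E ^ k)                          ≡⟨ lemma₃ (s₀ ^ n) E (S ^ n) (E ^ k) ⟩
    s₀ ^ n * S ^ n * (E * E ^ k)                          ∎
  ... | false = begin
    N * (a₀ ^ x * A ^ x * (b₀ ^ y * B ^ y))       ≡⟨ lemma₁ N (a₀ ^ x) (b₀ ^ y) (A ^ x) (B ^ y) ⟩
    a₀ ^ x * b₀ ^ y * (N * (A ^ x * B ^ y))       ≡⟨ cong₂ (λ a b → a ^ x * b ^ y * (N * (A ^ x * B ^ y))) (a≡s zero eq) (b≡s zero eq) ⟩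
    s₀ ^ x * s₀ ^ y * (N * (A ^ x * B ^ y))       ≡⟨ cong (_* (N * (A ^ x * B ^ y))) (^-distribˡ-+-* s₀ x y) ⟨
    s₀ ^ n * (N * (A ^ x * B ^ y))                ≤⟨ *-monoʳ-≤ (s₀ ^ n) IH ⟩
    s₀ ^ n * (S ^ n * E ^ k)                      ≡⟨ *-assoc (s₀ ^ n) (S ^ n) (E ^ k) ⟨
    s₀ ^ n * S ^ n * E ^ k                        ∎

^-comm : ∀ x m n → (x ^ m) ^ n ≡ (x ^ n) ^ m
^-comm x m n = trans (^-*-assoc x m n) (trans (cong (x ^_) (*-comm m n)) (sym (^-*-assoc x n m)))

^-cancelˡ-≤ : ∀ n .{{_ : NonZero n}} {x y} → x ^ n ≤ y ^ n → x ≤ y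
^-cancelˡ-≤ n {x} {y} le = ≮⇒≥ (λ y<x → <⇒≱ (^-monoˡ-< n y<x) le)

-- Superadditivity of the geometric mean of the c factors marked by J; the remaining
-- factors are common to the three products. Raising both sides to the power x + y turns
-- it into a product of instances of entropy-bound.
hölder : ∀ {x y m} (a b s : Fin m → ℕ) (J : Fin m → Bool) →
  (∀ j → J j ≡ true → s j ≡ a j + b j) → (∀ j → J j ≡ false → a j ≡ s j) → (∀ j → J j ≡ false → b j ≡ s j) →
  ∀ c .{{_ : NonZero c}} → sum (⟦_⟧ ∘ J) ≡ c → x ^ c ≤ ∏ a → y ^ c ≤ ∏ b → (x + y) ^ c ≤ ∏ s
hölder {x} {y} a b s J flagged a≡s b≡s c count x≤a y≤b = bound (x + y) refl
  where
  open ≤-Reasoning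
  E = x ^ x * y ^ y
  split : ∀ n → (n ^ c) ^ n * E ^ c ≡ (n ^ n) ^ c * ((x ^ c) ^ x * (y ^ c) ^ y)
  split n = cong₂ _*_ (^-comm n c n)
    (trans (^-distribʳ-* (x ^ x) (y ^ y) c) (cong₂ _*_ (^-comm x x c) (^-comm y y c)))
  bound : ∀ n → n ≡ x + y → n ^ c ≤ ∏ s
  -- No root of exponent `x + y = 0` can be taken; instead the left side is 0 because `c` is
  -- nonzero.
  bound zero      _  = ≤-trans (≤-reflexive (0^n≡0 c)) z≤n
    where
    0^n≡0 : ∀ n .{{_ : NonZero n}} → 0 ^ n ≡ 0
    0^n≡0 (suc n) = refl
  -- The cancelled `E` is nonzero even if `x` or `y` is 0, since `0 ^ 0 = 1`.
  bound n@(suc _) eq = ^-cancelˡ-≤ n (*-cancelʳ-≤ _ _ (E ^ c) {{m^n≢0 E c {{m*n≢0 (x ^ x) (y ^ y) {{n^n≢0 x}} {{n^n≢0 y}}}}}} (begin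
    (n ^ c) ^ n * E ^ c                         ≡⟨ split n ⟩
    (n ^ n) ^ c * ((x ^ c) ^ x * (y ^ c) ^ y)   ≤⟨ *-monoʳ-≤ ((n ^ n) ^ c) (*-mono-≤ (^-monoˡ-≤ x x≤a) (^-monoˡ-≤ y y≤b)) ⟩
    (n ^ n) ^ c * (∏ a ^ x * ∏ b ^ y)           ≤⟨ subst₂ (λ n k → (n ^ n) ^ k * (∏ a ^ x * ∏ b ^ y) ≤ ∏ s ^ n * E ^ k) (sym eq) count
                                                     (entropy-bound-∏ x y a b s J flagged a≡s b≡s) ⟩
    ∏ s ^ n * E ^ c                             ∎))

-- Sums over all subsets and Cauchy-Schwarz.

∑ : ∀ {n} → (Subset n → ℕ) → ℕ
∑ {zero}  f = f []
∑ {suc n} f = ∑ (f ∘ (outside ∷_)) + ∑ (f ∘ (inside ∷_))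

∑-cong : ∀ {n} {f g : Subset n → ℕ} → (∀ A → f A ≡ g A) → ∑ f ≡ ∑ g
∑-cong {zero}  f≡g = f≡g []
∑-cong {suc n} f≡g = cong₂ _+_ (∑-cong (λ A → f≡g (outside ∷ A))) (∑-cong (λ A → f≡g (inside ∷ A)))

∑-mono-≤ : ∀ {n} {f g : Subset n → ℕ} → (∀ A → f A ≤ g A) → ∑ f ≤ ∑ g
∑-mono-≤ {zero}  f≤g = f≤g []
∑-mono-≤ {suc n} f≤g = +-mono-≤ (∑-mono-≤ (λ A → f≤g (outside ∷ A))) (∑-mono-≤ (λ A → f≤g (inside ∷ A)))

+-interchange : ∀ a b c d → (a + b) + (c + d) ≡ (a + c) + (b + d)
+-interchange = solve-∀

∑-distrib-+ : ∀ {n} (f g : Subset n → ℕ) → ∑ (λ A → f A + g A) ≡ ∑ f + ∑ g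
∑-distrib-+ {zero}  f g = refl
∑-distrib-+ {suc n} f g = trans
  (cong₂ _+_ (∑-distrib-+ (f ∘ (outside ∷_)) (g ∘ (outside ∷_))) (∑-distrib-+ (f ∘ (inside ∷_)) (g ∘ (inside ∷_))))
  (+-interchange (∑ (f ∘ (outside ∷_))) _ _ _)

∑-distribˡ-* : ∀ {n} x (f : Subset n → ℕ) → ∑ (λ A → x * f A) ≡ x * ∑ f
∑-distribˡ-* {zero}  x f = refl
∑-distribˡ-* {suc n} x f = trans
  (cong₂ _+_ (∑-distribˡ-* x (f ∘ (outside ∷_))) (∑-distribˡ-* x (f ∘ (inside ∷_))))
  (sym (*-distribˡ-+ x _ _))

∑-distribʳ-* : ∀ {n} (f : Subset n → ℕ) x → ∑ (λ A → f A * x) ≡ ∑ f * x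
∑-distribʳ-* f x = trans (∑-cong (λ A → *-comm (f A) x)) (trans (∑-distribˡ-* x f) (*-comm x (∑ f)))

∑-comm : ∀ {m n} (f : Subset m → Subset n → ℕ) → ∑ (λ A → ∑ (f A)) ≡ ∑ (λ B → ∑ (λ A → f A B))
∑-comm {zero}  f = refl
∑-comm {suc m} f = trans
  (cong₂ _+_ (∑-comm (f ∘ (outside ∷_))) (∑-comm (f ∘ (inside ∷_))))
  (sym (∑-distrib-+ (λ B → ∑ (λ A → f (outside ∷ A) B)) _))

≤-∑ : ∀ {n} (f : Subset n → ℕ) A → f A ≤ ∑ f
≤-∑ f []            = ≤-refl
≤-∑ f (outside ∷ A) = ≤-trans (≤-∑ (f ∘ (outside ∷_)) A) (m≤m+n _ _)
≤-∑ f (inside ∷ A)  = ≤-trans (≤-∑ (f ∘ (inside ∷_)) A) (m≤n+m _ _)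

-- Distributivity: to choose one summand from each factor is to choose a subset. Sums over subsets
-- whose terms decouple over the coordinates are evaluated this way.
∑-∏ : ∀ {n} (a b : Fin n → ℕ) →
  ∑ (λ A → ∏ (λ i → if lookup A i then a i else b i)) ≡ ∏ (λ i → a i + b i)
∑-∏ {zero}  a b = refl
∑-∏ {suc n} a b = begin
  ∑ (λ A → b zero * rest A) + ∑ (λ A → a zero * rest A)   ≡⟨ cong₂ _+_ (∑-distribˡ-* (b zero) rest) (∑-distribˡ-* (a zero) rest) ⟩
  b zero * ∑ rest + a zero * ∑ rest                       ≡⟨ lemma (a zero) (b zero) (∑ rest) ⟩
  (a zero + b zero) * ∑ rest                              ≡⟨ cong ((a zero + b zero) *_) (∑-∏ (a ∘ suc) (b ∘ suc)) ⟩
  (a zero + b zero) * ∏ (λ i → a (suc i) + b (suc i))     ∎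
  where
  open ≡-Reasoning
  rest : Subset n → ℕ
  rest A = ∏ (λ i → if lookup A i then a (suc i) else b (suc i))
  lemma : ∀ a b r → b * r + a * r ≡ (a + b) * r
  lemma = solve-∀

-- The case of `hölder` with two factors, both marked.
cauchy-schwarz₂ : ∀ {x y} a a′ b b′ → x ^ 2 ≤ a * b → y ^ 2 ≤ a′ * b′ → (x + y) ^ 2 ≤ (a + a′) * (b + b′)
cauchy-schwarz₂ {x} {y} a a′ b b′ x≤ y≤ =
  subst ((x + y) ^ 2 ≤_) (pair (a + a′) (b + b′))
    (hölder {x} {y} (tuple a b) (tuple a′ b′) (tuple (a + a′) (b + b′)) (λ _ → true)
      (λ { zero _ → refl ; (suc zero) _ → refl }) (λ _ ()) (λ _ ()) 2 refl
      (subst (x ^ 2 ≤_) (sym (pair a b)) x≤) (subst (y ^ 2 ≤_) (sym (pair a′ b′)) y≤))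
  where
  tuple : ℕ → ℕ → Fin 2 → ℕ
  tuple u v zero    = u
  tuple u v (suc _) = v
  pair : ∀ u v → ∏ (tuple u v) ≡ u * v
  pair u v = cong (u *_) (*-identityʳ v)

-- The bound on `f A ^ 2` takes the place of the square root of `a A * b A`. The two halves of the
-- sum are merged by `cauchy-schwarz₂`.
cauchy-schwarz : ∀ {n} (f a b : Subset n → ℕ) → (∀ A → f A ^ 2 ≤ a A * b A) → ∑ f ^ 2 ≤ ∑ a * ∑ b
cauchy-schwarz {zero}  f a b f≤ = f≤ []
cauchy-schwarz {suc n} f a b f≤ = 
  cauchy-schwarz₂ {∑ (f ∘ (outside ∷_))} {∑ (f ∘ (inside ∷_))} (∑ (a ∘ (outside ∷_))) _ (∑ (b ∘ (outside ∷_))) _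
    (cauchy-schwarz (f ∘ (outside ∷_)) _ _ (λ A → f≤ (outside ∷ A)))
    (cauchy-schwarz (f ∘ (inside ∷_)) _ _ (λ A → f≤ (inside ∷ A)))

-- Finner's inequality.

disjoint : ∀ {n} → Subset n → Subset n → Bool
disjoint []      []      = true
disjoint (x ∷ A) (y ∷ B) = not (x ∧ y) ∧ disjoint A B

-- The function f is eliminated one coordinate at a time: summing over a coordinate in
-- D j turns p j + ε * q j into 2 * p j + ε * q j, where ε says that B and D j are disjoint.
finner : ∀ {n m} c .{{_ : NonZero c}} (D : Fin m → Subset n) (p q : Fin m → ℕ) (f : Subset n → ℕ) →
  (∀ i → sum (λ j → ⟦ lookup (D j) i ⟧) ≡ c) →
  (∀ B → f B ^ c ≤ ∏ (λ j → p j + ⟦ disjoint B (D j) ⟧ * q j)) →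
  ∑ f ^ c ≤ ∏ (λ j → 2 ^ ∣ D j ∣ * p j + q j)
finner {zero}  c D p q f _ f≤ = subst (f [] ^ c ≤_) (∏-cong (λ j → base (D j) (p j) (q j))) (f≤ [])
  where
  base : ∀ (d : Subset 0) p q → p + ⟦ disjoint [] d ⟧ * q ≡ 2 ^ ∣ d ∣ * p + q
  base [] p q = cong₂ _+_ (sym (*-identityˡ p)) (*-identityˡ q)
finner {suc n} c D p q f degree f≤ = subst₂ _≤_ (cong (_^ c) (∑-distrib-+ (f ∘ (outside ∷_)) (f ∘ (inside ∷_)))) (∏-cong (λ j → total (D j) (p j) (q j)))
  (finner c (tail ∘ D) (λ j → weight (head (D j)) (p j)) q (λ B → f (outside ∷ B) + f (inside ∷ B))
    (λ i → trans (sum-cong-≗ (λ j → cong ⟦_⟧ (lookup-tail (D j) i))) (degree (suc i)))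
    -- The bounds for the two values of the first coordinate are added by `hölder`. The marked
    -- factors are the `j` with this coordinate in `D j`, and `degree zero` says that there are
    -- exactly `c` of them.
    λ B → hölder _ _ _ (head ∘ D)
      (λ j → flagged (D j) B (p j) (q j)) (λ j → unflagged-out (D j) B (p j) (q j)) (λ j → unflagged-in (D j) B (p j) (q j))
      c (trans (sum-cong-≗ (λ j → cong ⟦_⟧ (lookup-head (D j)))) (degree zero))
      (f≤ (outside ∷ B)) (f≤ (inside ∷ B)))
  where
  weight : Bool → ℕ → ℕ
  weight x p = if x then 2 * p else p
  lookup-tail : ∀ (d : Subset (suc n)) i → lookup (tail d) i ≡ lookup d (suc i)
  lookup-tail (_ ∷ _) i = refl
  lookup-head : ∀ (d : Subset (suc n)) → head d ≡ lookup d zero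
  lookup-head (_ ∷ _) = refl
  total : ∀ (d : Subset (suc n)) p q → 2 ^ ∣ tail d ∣ * weight (head d) p + q ≡ 2 ^ ∣ d ∣ * p + q
  total (outside ∷ d) p q = refl
  total (inside ∷ d)  p q = cong (_+ q) (lemma (2 ^ ∣ d ∣) p)
    where
    lemma : ∀ u p → u * (2 * p) ≡ 2 * u * p
    lemma = solve-∀
  flagged : ∀ (d : Subset (suc n)) B p q → head d ≡ true →
    weight (head d) p + ⟦ disjoint B (tail d) ⟧ * q ≡
    (p + ⟦ disjoint (outside ∷ B) d ⟧ * q) + (p + ⟦ disjoint (inside ∷ B) d ⟧ * q)
  flagged (inside ∷ d) B p q refl = lemma p (⟦ disjoint B d ⟧ * q)
    where
    lemma : ∀ p u → 2 * p + u ≡ (p + u) + (p + 0)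
    lemma = solve-∀
  unflagged-out : ∀ (d : Subset (suc n)) B p q → head d ≡ false →
    p + ⟦ disjoint (outside ∷ B) d ⟧ * q ≡ weight (head d) p + ⟦ disjoint B (tail d) ⟧ * q
  unflagged-out (outside ∷ d) B p q refl = refl
  unflagged-in : ∀ (d : Subset (suc n)) B p q → head d ≡ false →
    p + ⟦ disjoint (inside ∷ B) d ⟧ * q ≡ weight (head d) p + ⟦ disjoint B (tail d) ⟧ * q
  unflagged-in (outside ∷ d) B p q refl = refl

-- Finite products, indicators and disjointness.

sum-const : ∀ n x → sum {n} (λ _ → x) ≡ n * x
sum-const zero    x = refl
sum-const (suc n) x = cong (_+_ x) (sum-const n x)

∏-const : ∀ n x → ∏ {n} (λ _ → x) ≡ x ^ n
∏-const zero    x = refl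
∏-const (suc n) x = cong (x *_) (∏-const n x)

∏-mono-≤ : ∀ {n} {f g : Fin n → ℕ} → (∀ i → f i ≤ g i) → ∏ f ≤ ∏ g
∏-mono-≤ {zero}  f≤g = ≤-refl
∏-mono-≤ {suc n} f≤g = *-mono-≤ (f≤g zero) (∏-mono-≤ (f≤g ∘ suc))

∏-^ : ∀ {n} (f : Fin n → ℕ) c → ∏ f ^ c ≡ ∏ (λ i → f i ^ c)
∏-^ {zero}  f c = ^-zeroˡ c
∏-^ {suc n} f c = trans (^-distribʳ-* (f zero) _ c) (cong (f zero ^ c *_) (∏-^ (f ∘ suc) c))

∏-⟦⟧ : ∀ {n} (b : Fin n → Bool) → (∀ i → b i ≡ true) ⊎ ∏ (⟦_⟧ ∘ b) ≡ 0
∏-⟦⟧ {zero}  b = inj₁ λ ()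
∏-⟦⟧ {suc n} b with b zero in eq
... | false = inj₂ refl
... | true  with ∏-⟦⟧ (b ∘ suc)
...   | inj₁ all = inj₁ λ { zero → eq ; (suc i) → all i }
...   | inj₂ ∏≡0 = inj₂ (trans (*-identityˡ _) ∏≡0)

∣A∣≡sum : ∀ {n} (A : Subset n) → ∣ A ∣ ≡ sum (λ i → ⟦ lookup A i ⟧)
∣A∣≡sum []            = refl
∣A∣≡sum (outside ∷ A) = ∣A∣≡sum A
∣A∣≡sum (inside ∷ A)  = cong suc (∣A∣≡sum A)

disjoint⁺ : ∀ {n} (A B : Subset n) → (∀ {i} → i ∈ A → i ∉ B) → disjoint A B ≡ true
disjoint⁺ []            []            _   = refl
disjoint⁺ (inside ∷ A)  (inside ∷ B)  A∦B = contradiction here (A∦B here)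
disjoint⁺ (inside ∷ A)  (outside ∷ B) A∦B = disjoint⁺ A B (λ i∈A i∈B → A∦B (there i∈A) (there i∈B))
disjoint⁺ (outside ∷ A) (_ ∷ B)       A∦B = disjoint⁺ A B (λ i∈A i∈B → A∦B (there i∈A) (there i∈B))

disjoint⁻ : ∀ {n} {A B : Subset n} → disjoint A B ≡ true → ∀ {i} → i ∈ A → i ∉ B
disjoint⁻ {A = inside ∷ A} () here here
disjoint⁻ {A = inside ∷ A} {outside ∷ B} d (there i∈A) (there i∈B) = disjoint⁻ d i∈A i∈B
disjoint⁻ {A = outside ∷ A} {_ ∷ B} d (there i∈A) (there i∈B) = disjoint⁻ d i∈A i∈B

-- Latin squares and the pairs that avoid a given set.

-- The relation i + j = k, presented symmetrically in its three arguments: each of the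
-- functions recovers the named argument from the other two, taken in cyclic order.
record LatinSquare (n : ℕ) : Set where
  field
    third first second : Fin n → Fin n → Fin n
    third⇒first  : ∀ {i j k} → third i j ≡ k → first j k ≡ i
    first⇒second : ∀ {i j k} → first j k ≡ i → second k i ≡ j
    second⇒third : ∀ {i j k} → second k i ≡ j → third i j ≡ k

-- By this cyclic symmetry each estimate proved for the first set of a triple also serves for the
-- second and the third.
rotate : ∀ {n} → LatinSquare n → LatinSquare n
rotate L = record
  { third = first ; first = second ; second = third
  ; third⇒first = first⇒second ; first⇒second = second⇒third ; second⇒third = third⇒first }
  where open LatinSquare L

module _ {n : ℕ} (L : LatinSquare n) where
  open LatinSquare L

  Avoids : Subset n → Subset n → Subset n → Set
  Avoids A B C = ∀ i j k → i ∈ A → j ∈ B → k ∈ C → third i j ≢ k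

  avoids? : ∀ A B C → Dec (Avoids A B C)
  avoids? A B C = all? λ i → all? λ j → all? λ k →
    (i ∈? A) →-dec ((j ∈? B) →-dec ((k ∈? C) →-dec ¬? (third i j ≟ k)))

  χ : Subset n → Subset n → Subset n → ℕ
  χ A B C = ⟦ does (avoids? A B C) ⟧

  χ≡1 : ∀ {A B C} → Avoids A B C → χ A B C ≡ 1
  χ≡1 {A} {B} {C} avoids = cong ⟦_⟧ (dec-true (avoids? A B C) avoids)

  χ≡0 : ∀ {A B C} → ¬ Avoids A B C → χ A B C ≡ 0
  χ≡0 {A} {B} {C} ¬avoids = cong ⟦_⟧ (dec-false (avoids? A B C) ¬avoids)

  -- C avoids A and B when no k ∈ C has a point of B in the slice of A at k.
  slice : Subset n → Fin n → Subset n
  slice A k = tabulate (λ j → lookup A (first j k))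

  ∈-slice⁺ : ∀ {A i j k} → i ∈ A → third i j ≡ k → j ∈ slice A k
  ∈-slice⁺ {A} {j = j} {k} i∈A eq = lookup⇒[]= j (slice A k)
    (trans (lookup∘tabulate _ j) (trans (cong (lookup A) (third⇒first eq)) ([]=⇒lookup i∈A)))

  ∈-slice⁻ : ∀ {A j k} → j ∈ slice A k → first j k ∈ A
  ∈-slice⁻ {A} {j} {k} j∈ = lookup⇒[]= (first j k) A (trans (sym (lookup∘tabulate _ j)) ([]=⇒lookup j∈))

  first-inverse : ∀ {j k} → third (first j k) j ≡ k
  first-inverse = second⇒third (first⇒second refl)

  -- For fixed `k` the map sending `j` to `first j k` is a permutation.
  ∣slice∣ : ∀ A k → ∣ slice A k ∣ ≡ ∣ A ∣
  ∣slice∣ A k = begin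
    ∣ slice A k ∣                              ≡⟨ ∣A∣≡sum (slice A k) ⟩
    sum (λ j → ⟦ lookup (slice A k) j ⟧)       ≡⟨ sum-cong-≗ (λ j → cong ⟦_⟧ (lookup∘tabulate (λ j → lookup A (first j k)) j)) ⟩
    sum (λ j → ⟦ lookup A (first j k) ⟧)       ≡⟨ sum-permute (λ i → ⟦ lookup A i ⟧) π ⟨
    sum (λ i → ⟦ lookup A i ⟧)                 ≡⟨ ∣A∣≡sum A ⟨
    ∣ A ∣                                      ∎
    where
    open ≡-Reasoning
    π : Permutation′ n
    π = permutation (λ j → first j k) (second k) (λ i → third⇒first (second⇒third refl)) (λ j → first⇒second refl)

  -- Here `j` is fixed and `k` varies, which again gives a permutation. This is the regularity that
  -- `finner` asks for.
  slice-degree : ∀ A j → sum (λ k → ⟦ lookup (slice A k) j ⟧) ≡ ∣ A ∣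
  slice-degree A j = begin
    sum (λ k → ⟦ lookup (slice A k) j ⟧)       ≡⟨ sum-cong-≗ (λ k → cong ⟦_⟧ (lookup∘tabulate (λ j → lookup A (first j k)) j)) ⟩
    sum (λ k → ⟦ lookup A (first j k) ⟧)       ≡⟨ sum-permute (λ i → ⟦ lookup A i ⟧) π ⟨
    sum (λ i → ⟦ lookup A i ⟧)                 ≡⟨ ∣A∣≡sum A ⟨
    ∣ A ∣                                      ∎
    where
    open ≡-Reasoning
    π : Permutation′ n
    π = permutation (first j) (λ i → third i j) (λ i → third⇒first refl) (λ k → first-inverse)

  -- With `A` and `B` fixed, avoidance is a separate condition on each element of `C`, so the sum
  -- over `C` will factorise.
  χ-∏ : ∀ A B C → χ A B C ≡ ∏ (λ k → if lookup C k then ⟦ disjoint B (slice A k) ⟧ else 1)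
  χ-∏ A B C = sym (trans (∏-cong (λ k → push (lookup C k))) (decided (avoids? A B C)))
    where
    test : Fin n → Bool
    test k = if lookup C k then disjoint B (slice A k) else true
    push : ∀ c {d} → (if c then ⟦ d ⟧ else 1) ≡ ⟦ (if c then d else true) ⟧
    push true  = refl
    push false = refl
    decided : Dec (Avoids A B C) → ∏ (⟦_⟧ ∘ test) ≡ χ A B C
    decided (yes avoids) = trans (∏-cong (cong ⟦_⟧ ∘ pass)) (trans (trans (∏-const n 1) (^-zeroˡ n)) (sym (χ≡1 avoids)))
      where
      pass : ∀ k → test k ≡ true
      pass k with lookup C k in k∈C
      ... | false = refl
      ... | true  = disjoint⁺ B (slice A k) λ j∈B j∈slice →
        avoids _ _ k (∈-slice⁻ j∈slice) j∈B (lookup⇒[]= k C k∈C) first-inverse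
    decided (no ¬avoids) with ∏-⟦⟧ test
    ... | inj₂ ∏≡0 = trans ∏≡0 (sym (χ≡0 ¬avoids))
    ... | inj₁ all = contradiction avoids ¬avoids
      where
      avoids : Avoids A B C
      avoids i j k i∈A j∈B k∈C eq = disjoint⁻ (subst (λ c → (if c then disjoint B (slice A k) else true) ≡ true) ([]=⇒lookup k∈C) (all k))
        j∈B (∈-slice⁺ i∈A eq)

  -- An index `k` is free to lie in `C` or not if its slice misses `B`, and is excluded otherwise:
  -- two choices or one.
  ∑χ : ∀ A B → ∑ (χ A B) ≡ ∏ (λ k → ⟦ disjoint B (slice A k) ⟧ + 1)
  ∑χ A B = trans (∑-cong (χ-∏ A B)) (∑-∏ {n} _ (λ _ → 1))

  pairs : Subset n → ℕ
  pairs A = ∑ λ B → ∑ λ C → χ A B C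

  -- Apply `finner` to the product in `∑χ` with `p = 1` and `q = 2 ^ c`, using
  -- `(ε + 1) ^ c ≤ 1 + ε * 2 ^ c` for `ε` equal to 0 or 1. All slices have size `c`, so each factor
  -- of the result is `2 ^ c + 2 ^ c`.
  pairs-^ : ∀ A c .{{_ : NonZero c}} → ∣ A ∣ ≡ c → pairs A ^ c ≤ (2 ^ suc c) ^ n
  pairs-^ A c ∣A∣≡c = begin
    pairs A ^ c                                        ≤⟨ finner c (slice A) (λ _ → 1) (λ _ → 2 ^ c) _ (λ j → trans (slice-degree A j) ∣A∣≡c) bound ⟩
    ∏ (λ k → 2 ^ ∣ slice A k ∣ * 1 + 2 ^ c)            ≡⟨ ∏-cong (λ k → cong (λ s → 2 ^ s * 1 + 2 ^ c) (trans (∣slice∣ A k) ∣A∣≡c)) ⟩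
    ∏ {n} (λ k → 2 ^ c * 1 + 2 ^ c)                    ≡⟨ ∏-const n _ ⟩
    (2 ^ c * 1 + 2 ^ c) ^ n                            ≡⟨ cong (_^ n) (lemma (2 ^ c)) ⟩
    (2 ^ suc c) ^ n                                    ∎
    where
    open ≤-Reasoning
    lemma : ∀ u → u * 1 + u ≡ 2 * u
    lemma = solve-∀
    indicator-^ : ∀ b → (⟦ b ⟧ + 1) ^ c ≤ 1 + ⟦ b ⟧ * 2 ^ c
    indicator-^ true  = ≤-trans (m≤m+n (2 ^ c) 0) (n≤1+n _)
    indicator-^ false = ≤-reflexive (^-zeroˡ c)
    bound : ∀ B → ∑ (χ A B) ^ c ≤ ∏ (λ k → 1 + ⟦ disjoint B (slice A k) ⟧ * 2 ^ c)
    bound B = begin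
      ∑ (χ A B) ^ c                                      ≡⟨ cong (_^ c) (∑χ A B) ⟩
      ∏ (λ k → ⟦ disjoint B (slice A k) ⟧ + 1) ^ c       ≡⟨ ∏-^ {n} _ c ⟩
      ∏ (λ k → (⟦ disjoint B (slice A k) ⟧ + 1) ^ c)     ≤⟨ ∏-mono-≤ (λ k → indicator-^ (disjoint B (slice A k))) ⟩
      ∏ (λ k → 1 + ⟦ disjoint B (slice A k) ⟧ * 2 ^ c)   ∎

  pairs-⊥ : pairs ⊥ ≡ 4 ^ n
  pairs-⊥ = begin
    pairs ⊥                                     ≡⟨ ∑-cong (λ B → ∑χ ⊥ B) ⟩
    ∑ (λ B → ∏ (λ k → ⟦ disjoint B (slice ⊥ k) ⟧ + 1))  ≡⟨ ∑-cong (λ B → ∏-cong (weight≡2 B)) ⟩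
    -- The constant 2 is written as a choice so that `∑-∏` applies, which gives `2 + 2` in each
    -- coordinate.
    ∑ {n} (λ B → ∏ (λ k → if lookup B k then 2 else 2))     ≡⟨ ∑-∏ {n} (λ _ → 2) (λ _ → 2) ⟩
    ∏ {n} (λ k → 4)                             ≡⟨ ∏-const n 4 ⟩
    4 ^ n                                       ∎
    where
    open ≡-Reasoning
    empty : ∀ B k → disjoint B (slice ⊥ k) ≡ true
    empty B k = disjoint⁺ B (slice ⊥ k) (λ _ j∈ → ∉⊥ (∈-slice⁻ j∈))
    weight≡2 : ∀ B k → ⟦ disjoint B (slice ⊥ k) ⟧ + 1 ≡ (if lookup B k then 2 else 2)
    weight≡2 B k rewrite empty B k with lookup B k
    ... | true  = refl
    ... | false = refl

  -- The slice at `k` is the single point `second k i`. Reindexing by this permutation gives each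
  -- point weight 1 inside `B` and 2 outside, hence a factor 3.
  pairs-⁅⁆ : ∀ i → pairs ⁅ i ⁆ ≡ 3 ^ n
  pairs-⁅⁆ i = begin
    pairs ⁅ i ⁆                                             ≡⟨ ∑-cong (λ B → ∑χ ⁅ i ⁆ B) ⟩
    ∑ (λ B → ∏ (λ k → ⟦ disjoint B (slice ⁅ i ⁆ k) ⟧ + 1))  ≡⟨ ∑-cong (λ B → ∏-cong (λ k → point B k)) ⟩
    ∑ (λ B → ∏ (λ k → weight B (second k i)))               ≡⟨ ∑-cong (λ B → ∏-permute (weight B) π) ⟨
    ∑ (λ B → ∏ (weight B))                                  ≡⟨ ∑-∏ {n} (λ _ → 1) (λ _ → 2) ⟩
    ∏ {n} (λ k → 3)                                         ≡⟨ ∏-const n 3 ⟩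
    3 ^ n                                                   ∎
    where
    open ≡-Reasoning
    weight : Subset n → Fin n → ℕ
    weight B j = if lookup B j then 1 else 2
    π : Permutation′ n
    π = permutation (λ k → second k i) (third i) (λ j → first⇒second (third⇒first refl)) (λ k → second⇒third refl)
    point : ∀ B k → ⟦ disjoint B (slice ⁅ i ⁆ k) ⟧ + 1 ≡ weight B (second k i)
    point B k with lookup B (second k i) in eq
    ... | true  = cong (λ b → ⟦ b ⟧ + 1) (¬-not λ d →
      disjoint⁻ d (lookup⇒[]= (second k i) B eq) (∈-slice⁺ (x∈⁅x⁆ i) (second⇒third refl)))
    ... | false = cong (λ b → ⟦ b ⟧ + 1) (disjoint⁺ B (slice ⁅ i ⁆ k) λ {j} j∈B j∈slice →
      contradiction (trans (sym (trans (cong (lookup B) (first⇒second (x∈⁅y⁆⇒x≡y i (∈-slice⁻ j∈slice)))) ([]=⇒lookup j∈B))) eq) λ ())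

  χ-mono : ∀ {A A₀ B B₀ C C₀} → A₀ ⊆ A → B₀ ⊆ B → C₀ ⊆ C → χ A B C ≤ χ A₀ B₀ C₀
  χ-mono {A} {A₀} {B} {B₀} {C} {C₀} A₀⊆A B₀⊆B C₀⊆C = decided (avoids? A B C)
    where
    decided : Dec (Avoids A B C) → χ A B C ≤ χ A₀ B₀ C₀
    decided (yes avoids) = ≤-reflexive (trans (χ≡1 avoids) (sym (χ≡1
      (λ i j k i∈A j∈B k∈C → avoids i j k (A₀⊆A i∈A) (B₀⊆B j∈B) (C₀⊆C k∈C)))))
    decided (no ¬avoids) = ≤-trans (≤-reflexive (χ≡0 ¬avoids)) z≤n

χ-rotate : ∀ {n} (L : LatinSquare n) A B C → χ L A B C ≡ χ (rotate L) B C A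
χ-rotate L A B C = decided (avoids? L A B C)
  where
  open LatinSquare L
  decided : Dec (Avoids L A B C) → χ L A B C ≡ χ (rotate L) B C A
  decided (yes avoids) = trans (χ≡1 L avoids) (sym (χ≡1 (rotate L)
    (λ j k i j∈B k∈C i∈A eq → avoids i j k i∈A j∈B k∈C (second⇒third (first⇒second eq)))))
  decided (no ¬avoids) = trans (χ≡0 L ¬avoids) (sym (χ≡0 (rotate L)
    (λ avoids → ¬avoids (λ i j k i∈A j∈B k∈C eq → avoids j k i j∈B k∈C i∈A (third⇒first eq)))))

-- Counting subsets by size.

∑-zero : ∀ n → ∑ {n} (λ _ → 0) ≡ 0
∑-zero zero    = refl
∑-zero (suc n) = cong₂ _+_ (∑-zero n) (∑-zero n)

∑-one : ∀ n → ∑ {n} (λ _ → 1) ≡ 2 ^ n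
∑-one zero    = refl
∑-one (suc n) = trans (cong₂ _+_ (∑-one n) (∑-one n)) (cong (_+_ (2 ^ n)) (sym (+-identityʳ (2 ^ n))))

∑∑-* : ∀ {m n} (f : Subset m → ℕ) (g : Subset n → ℕ) → ∑ (λ A → ∑ (λ B → f A * g B)) ≡ ∑ f * ∑ g
∑∑-* f g = trans (∑-cong (λ A → ∑-distribˡ-* (f A) g)) (∑-distribʳ-* f (∑ g))

-- The test has the form `<ᵇ 1` because `suc m ≤ᵇ 1` reduces to `m <ᵇ 1`; this is the inside half of
-- `∑-size-≤1`.
∑-size-0 : ∀ {n} (f : Subset n → ℕ) → ∑ (λ A → ⟦ ∣ A ∣ <ᵇ 1 ⟧ * f A) ≡ f ⊥
∑-size-0 {zero}  f = +-identityʳ (f [])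
∑-size-0 {suc n} f = trans (cong₂ _+_ (∑-size-0 (f ∘ (outside ∷_))) (∑-zero n)) (+-identityʳ _)

∑-size-≤1 : ∀ {n} (f : Subset n → ℕ) → ∑ (λ A → ⟦ ∣ A ∣ ≤ᵇ 1 ⟧ * f A) ≡ f ⊥ + sum (f ∘ ⁅_⁆)
∑-size-≤1 {zero}  f = refl
∑-size-≤1 {suc n} f = begin
  ∑ (λ A → ⟦ ∣ A ∣ ≤ᵇ 1 ⟧ * f (outside ∷ A)) + ∑ (λ A → ⟦ ∣ A ∣ <ᵇ 1 ⟧ * f (inside ∷ A))
    ≡⟨ cong₂ _+_ (∑-size-≤1 (f ∘ (outside ∷_))) (∑-size-0 (f ∘ (inside ∷_))) ⟩
  f (outside ∷ ⊥) + sum (λ i → f (outside ∷ ⁅ i ⁆)) + f (inside ∷ ⊥)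
    ≡⟨ lemma (f (outside ∷ ⊥)) _ (f (inside ∷ ⊥)) ⟩
  f (outside ∷ ⊥) + (f (inside ∷ ⊥) + sum (λ i → f (outside ∷ ⁅ i ⁆)))  ∎
  where
  open ≡-Reasoning
  lemma : ∀ a b c → a + b + c ≡ a + (c + b)
  lemma = solve-∀

-- Each set of size at most k has weight q ^ (n ∸ ∣ A ∣) ≥ q ^ n / q ^ k in (1 + q) ^ n.
∑-size-tail : ∀ n k q .{{_ : NonZero q}} → ∑ {n} (λ A → ⟦ ∣ A ∣ ≤ᵇ k ⟧) * q ^ n ≤ q ^ k * suc q ^ n
∑-size-tail zero    k       q = *-monoˡ-≤ 1 (m^n>0 q k)
∑-size-tail (suc n) zero    q = begin
  (small + ∑ {n} (λ _ → 0)) * (q * q ^ n)   ≡⟨ cong (λ z → (small + z) * (q * q ^ n)) (∑-zero n) ⟩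
  (small + 0) * (q * q ^ n)                 ≡⟨ lemma small q (q ^ n) ⟩
  q * (small * q ^ n)                       ≤⟨ *-mono-≤ (n≤1+n q) (∑-size-tail n 0 q) ⟩
  suc q * (1 * suc q ^ n)                   ≡⟨ cong (suc q *_) (*-identityˡ (suc q ^ n)) ⟩
  suc q ^ suc n                             ≡⟨ *-identityˡ (suc q ^ suc n) ⟨
  1 * suc q ^ suc n                         ∎
  where
  open ≤-Reasoning
  small = ∑ {n} (λ A → ⟦ ∣ A ∣ ≤ᵇ 0 ⟧)
  lemma : ∀ s q p → (s + 0) * (q * p) ≡ q * (s * p)
  lemma = solve-∀
∑-size-tail (suc n) (suc k) q = begin
  (small + ∑ {n} (λ A → ⟦ ∣ A ∣ <ᵇ suc k ⟧)) * (q * q ^ n)   ≡⟨ cong (λ z → (small + z) * (q * q ^ n)) (∑-cong {n} (λ A → cong ⟦_⟧ (<ᵇ-suc ∣ A ∣))) ⟩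
  (small + smaller) * (q * q ^ n)                            ≡⟨ lemma₁ small smaller q (q ^ n) ⟩
  q * (small * q ^ n) + q * (smaller * q ^ n)                ≤⟨ +-mono-≤ (*-monoʳ-≤ q (∑-size-tail n (suc k) q)) (*-monoʳ-≤ q (∑-size-tail n k q)) ⟩
  q * (q ^ suc k * suc q ^ n) + q * (q ^ k * suc q ^ n)      ≡⟨ lemma₂ q (q ^ k) (suc q ^ n) ⟩
  q ^ suc k * suc q ^ suc n                                  ∎
  where
  open ≤-Reasoning
  small   = ∑ {n} (λ A → ⟦ ∣ A ∣ ≤ᵇ suc k ⟧)
  smaller = ∑ {n} (λ A → ⟦ ∣ A ∣ ≤ᵇ k ⟧)
  <ᵇ-suc : ∀ m → (m <ᵇ suc k) ≡ (m ≤ᵇ k)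
  <ᵇ-suc zero    = refl
  <ᵇ-suc (suc m) = refl
  lemma₁ : ∀ s t q p → (s + t) * (q * p) ≡ q * (s * p) + q * (t * p)
  lemma₁ = solve-∀
  lemma₂ : ∀ q u p → q * (q * u * p) + q * (u * p) ≡ q * u * (suc q * p)
  lemma₂ = solve-∀

-- The bound `pairs-^` is for an exact size. As avoidance passes to subsets, a larger set can be
-- replaced by one of that size.
shrink : ∀ {n} k (A : Subset n) → k ≤ ∣ A ∣ → ∃[ A₀ ] (A₀ ⊆ A × ∣ A₀ ∣ ≡ k)
shrink zero    []            _   = [] , ⊆-refl , refl
shrink k       (outside ∷ A) k≤ with shrink k A k≤
... | A₀ , A₀⊆A , size = outside ∷ A₀ , out⊆ A₀⊆A , size
shrink zero    (inside ∷ A)  _   with shrink zero A z≤n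
... | A₀ , A₀⊆A , size = outside ∷ A₀ , out⊆ A₀⊆A , size
shrink (suc k) (inside ∷ A)  (s≤s k≤) with shrink k A k≤
... | A₀ , A₀⊆A , size = inside ∷ A₀ , in⊆in A₀⊆A , cong suc size

-- The Loomis-Whitney inequality and sums over triples.

-- Because the values are at most 1, the sum `x` over `C` is at most both `ḡ B` and `h̄ A`, so
-- `x * x ≤ h̄ A * ḡ B`. Cauchy-Schwarz over `B` and then over `A` separates `f` from this product,
-- whose double sum factorises.
loomis-whitney : ∀ {n} (f g h : Subset n → Subset n → ℕ) →
  (∀ A B → f A B ≤ 1) → (∀ A B → g A B ≤ 1) → (∀ A B → h A B ≤ 1) →
  ∑ (λ A → ∑ λ B → ∑ λ C → f A B * (g B C * h C A)) ^ 2 ≤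
  ∑ (λ A → ∑ λ B → f A B) * (∑ (λ A → ∑ λ B → g A B) * ∑ (λ A → ∑ λ B → h A B))
loomis-whitney f g h f≤1 g≤1 h≤1 = begin
  ∑ (λ A → ∑ λ B → ∑ λ C → f A B * (g B C * h C A)) ^ 2
    ≤⟨ cauchy-schwarz _ (λ A → ∑ (f A)) (λ A → ∑ λ B → h̄ A * ḡ B) (λ A → cauchy-schwarz _ (f A) (λ B → h̄ A * ḡ B) (pointwise A)) ⟩
  ∑ (λ A → ∑ (f A)) * ∑ (λ A → ∑ λ B → h̄ A * ḡ B)
    ≡⟨ cong (∑ (λ A → ∑ (f A)) *_) (trans (∑∑-* h̄ ḡ) (*-comm (∑ h̄) (∑ ḡ))) ⟩
  ∑ (λ A → ∑ (f A)) * (∑ ḡ * ∑ h̄)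
    ≡⟨ cong (λ z → ∑ (λ A → ∑ (f A)) * (∑ ḡ * z)) (∑-comm h) ⟨
  ∑ (λ A → ∑ (f A)) * (∑ ḡ * ∑ (λ C → ∑ (h C)))  ∎
  where
  open ≤-Reasoning
  ḡ = λ B → ∑ (g B)
  h̄ = λ A → ∑ (λ C → h C A)
  lemma : ∀ a x → a * x * (a * x * 1) ≡ a * (a * (x * x))
  lemma = solve-∀
  pointwise : ∀ A B → ∑ (λ C → f A B * (g B C * h C A)) ^ 2 ≤ f A B * (h̄ A * ḡ B)
  pointwise A B = begin
    ∑ (λ C → f A B * (g B C * h C A)) ^ 2   ≡⟨ cong (_^ 2) (∑-distribˡ-* (f A B) (λ C → g B C * h C A)) ⟩
    (f A B * x) ^ 2                         ≡⟨ lemma (f A B) x ⟩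
    f A B * (f A B * (x * x))               ≤⟨ *-monoʳ-≤ (f A B) (*-mono-≤ (f≤1 A B) (*-mono-≤ x≤h̄ x≤ḡ)) ⟩
    f A B * (1 * (h̄ A * ḡ B))               ≡⟨ cong (f A B *_) (*-identityˡ _) ⟩
    f A B * (h̄ A * ḡ B)                     ∎
    where
    x = ∑ (λ C → g B C * h C A)
    x≤ḡ : x ≤ ḡ B
    x≤ḡ = ∑-mono-≤ (λ C → ≤-trans (*-monoʳ-≤ (g B C) (h≤1 C A)) (≤-reflexive (*-identityʳ _)))
    x≤h̄ : x ≤ h̄ A
    x≤h̄ = ∑-mono-≤ (λ C → ≤-trans (*-monoˡ-≤ (h C A) (g≤1 B C)) (≤-reflexive (*-identityˡ _)))

∑³ : ∀ {n} → (Subset n → Subset n → Subset n → ℕ) → ℕ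
∑³ f = ∑ λ A → ∑ λ B → ∑ λ C → f A B C

∑³-cong : ∀ {n} {f g : Subset n → Subset n → Subset n → ℕ} → (∀ A B C → f A B C ≡ g A B C) → ∑³ f ≡ ∑³ g
∑³-cong f≡g = ∑-cong λ A → ∑-cong λ B → ∑-cong λ C → f≡g A B C

∑³-mono-≤ : ∀ {n} {f g : Subset n → Subset n → Subset n → ℕ} → (∀ A B C → f A B C ≤ g A B C) → ∑³ f ≤ ∑³ g
∑³-mono-≤ f≤g = ∑-mono-≤ λ A → ∑-mono-≤ λ B → ∑-mono-≤ λ C → f≤g A B C

∑³-distrib-+ : ∀ {n} (f g : Subset n → Subset n → Subset n → ℕ) → ∑³ (λ A B C → f A B C + g A B C) ≡ ∑³ f + ∑³ g
∑³-distrib-+ f g =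
  trans (∑-cong λ A → trans (∑-cong λ B → ∑-distrib-+ (f A B) (g A B)) (∑-distrib-+ (λ B → ∑ (f A B)) _))
        (∑-distrib-+ (λ A → ∑ λ B → ∑ (f A B)) _)

∑³-rotate : ∀ {n} (f : Subset n → Subset n → Subset n → ℕ) → ∑³ f ≡ ∑³ (λ B C A → f A B C)
∑³-rotate f = trans (∑-comm (λ A B → ∑ (f A B))) (∑-cong λ B → ∑-comm (λ A → f A B))

module _ {n : ℕ} (L : LatinSquare n) where

  ∑³-first : ∀ (w : Subset n → ℕ) → ∑³ (λ A B C → w A * χ L A B C) ≡ ∑ (λ A → w A * pairs L A)
  ∑³-first w = ∑-cong λ A →
    trans (∑-cong λ B → ∑-distribˡ-* (w A) (χ L A B)) (∑-distribˡ-* (w A) (λ B → ∑ (χ L A B)))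

∑³-second : ∀ {n} (L : LatinSquare n) (w : Subset n → ℕ) → ∑³ (λ A B C → w B * χ L A B C) ≡ ∑ (λ B → w B * pairs (rotate L) B)
∑³-second L w = trans (∑³-rotate (λ A B C → w B * χ L A B C))
  (trans (∑³-cong λ B C A → cong (w B *_) (χ-rotate L A B C)) (∑³-first (rotate L) w))

∑³-third : ∀ {n} (L : LatinSquare n) (w : Subset n → ℕ) → ∑³ (λ A B C → w C * χ L A B C) ≡ ∑ (λ C → w C * pairs (rotate (rotate L)) C)
∑³-third L w = trans (∑³-rotate (λ A B C → w C * χ L A B C))
  (trans (∑³-cong λ B C A → cong (w C *_) (χ-rotate L A B C)) (∑³-second (rotate L) w))

-- Bounds for sets of small, medium and large size.

-- The fraction `e / d` is an upper bound for the root of order `c` of `a`, and the conclusion is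
-- `x ≤ (e / d) ^ n` with denominators cleared.
root-bound : ∀ c .{{_ : NonZero c}} {x} a d e n → x ^ c ≤ a ^ n → a * d ^ c ≤ e ^ c → x * d ^ n ≤ e ^ n
root-bound c {x} a d e n x≤a a≤e = ^-cancelˡ-≤ c (begin
  (x * d ^ n) ^ c        ≡⟨ ^-distribʳ-* x (d ^ n) c ⟩
  x ^ c * (d ^ n) ^ c    ≡⟨ cong (x ^ c *_) (^-comm d n c) ⟩
  x ^ c * (d ^ c) ^ n    ≤⟨ *-monoˡ-≤ _ x≤a ⟩
  a ^ n * (d ^ c) ^ n    ≡⟨ ^-distribʳ-* a (d ^ c) n ⟨
  (a * d ^ c) ^ n        ≤⟨ ^-monoˡ-≤ n a≤e ⟩
  (e ^ c) ^ n            ≡⟨ ^-comm e c n ⟩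
  (e ^ n) ^ c            ∎)
  where open ≤-Reasoning

⟦⟧≤1 : ∀ b → ⟦ b ⟧ ≤ 1
⟦⟧≤1 true  = ≤-refl
⟦⟧≤1 false = z≤n

-- At the end k = 32. The factor (101/100)^n comes from the number of sets of size at most
-- k (∑-size-tail with q = 100); 283/100 and 41/20 are upper bounds for √8 and 2^(33/32).
-- The base 299/100 exceeds both 1.01 · 2.83 and (1.01 · 2.05)^(3/2).
small : ∀ {n} → Subset n → ℕ
small A = ⟦ ∣ A ∣ ≤ᵇ 1 ⟧

medium large : ∀ {n} → ℕ → Subset n → ℕ
medium k A = ⟦ not (∣ A ∣ ≤ᵇ 1) ∧ (∣ A ∣ ≤ᵇ k) ⟧
large  k A = ⟦ not (∣ A ∣ ≤ᵇ k) ⟧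

≤ᵇ-false : ∀ m k → (m ≤ᵇ k) ≡ false → k < m
≤ᵇ-false m k eq = ≰⇒> λ m≤k → subst T eq (≤⇒≤ᵇ m≤k)

module _ {n : ℕ} (L : LatinSquare n) where

  pairs-mono : ∀ {A A₀} → A₀ ⊆ A → pairs L A ≤ pairs L A₀
  pairs-mono A₀⊆A = ∑-mono-≤ λ B → ∑-mono-≤ λ C → χ-mono L A₀⊆A (⊆-refl {x = B}) (⊆-refl {x = C})

  ∑-small-pairs : ∑ (λ A → small A * pairs L A) ≡ 4 ^ n + n * 3 ^ n
  ∑-small-pairs = trans (∑-size-≤1 (pairs L))
    (cong₂ _+_ (pairs-⊥ L) (trans (sum-cong-≗ (pairs-⁅⁆ L)) (sum-const n (3 ^ n))))

  -- Each `A` contributes at most `(e / d) ^ n`, and only if it has at most `k` elements; by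
  -- `∑-size-tail` there are at most `100 ^ k * (101 / 100) ^ n` such sets.
  ∑-pairs-bound : ∀ (w : Subset n → ℕ) k d e → (∀ A → w A * pairs L A * d ^ n ≤ ⟦ ∣ A ∣ ≤ᵇ k ⟧ * e ^ n) →
    ∑ (λ A → w A * pairs L A) * (d * 100) ^ n ≤ 100 ^ k * (101 * e) ^ n
  ∑-pairs-bound w k d e w≤ = begin
    P * (d * 100) ^ n              ≡⟨ cong (P *_) (^-distribʳ-* d 100 n) ⟩
    P * (d ^ n * 100 ^ n)          ≡⟨ *-assoc P (d ^ n) (100 ^ n) ⟨
    P * d ^ n * 100 ^ n            ≡⟨ cong (_* 100 ^ n) (∑-distribʳ-* (λ A → w A * pairs L A) (d ^ n)) ⟨
    ∑ (λ A → w A * pairs L A * d ^ n) * 100 ^ n   ≤⟨ *-monoˡ-≤ (100 ^ n) (∑-mono-≤ w≤) ⟩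
    ∑ {n} (λ A → ⟦ ∣ A ∣ ≤ᵇ k ⟧ * e ^ n) * 100 ^ n    ≡⟨ cong (_* 100 ^ n) (∑-distribʳ-* {n} (λ A → ⟦ ∣ A ∣ ≤ᵇ k ⟧) (e ^ n)) ⟩
    N * e ^ n * 100 ^ n            ≡⟨ lemma N (e ^ n) (100 ^ n) ⟩
    N * 100 ^ n * e ^ n            ≤⟨ *-monoˡ-≤ (e ^ n) (∑-size-tail n k 100) ⟩
    100 ^ k * 101 ^ n * e ^ n      ≡⟨ *-assoc (100 ^ k) (101 ^ n) (e ^ n) ⟩
    100 ^ k * (101 ^ n * e ^ n)    ≡⟨ cong (100 ^ k *_) (^-distribʳ-* 101 e n) ⟨
    100 ^ k * (101 * e) ^ n        ∎
    where
    open ≤-Reasoning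
    P = ∑ λ A → w A * pairs L A
    N = ∑ {n} λ A → ⟦ ∣ A ∣ ≤ᵇ k ⟧
    lemma : ∀ a b c → a * b * c ≡ a * c * b
    lemma = solve-∀

  ∑-medium-pairs : ∀ k → ∑ (λ A → medium k A * pairs L A) * 100 ^ n ≤ 100 ^ k * 299 ^ n
  ∑-medium-pairs k = *-cancelʳ-≤ _ _ (100 ^ n) {{m^n≢0 100 n}} (begin
    P * 100 ^ n * 100 ^ n               ≡⟨ *-assoc P (100 ^ n) (100 ^ n) ⟩
    P * (100 ^ n * 100 ^ n)             ≡⟨ cong (P *_) (^-distribʳ-* 100 100 n) ⟨
    P * (100 * 100) ^ n                 ≤⟨ ∑-pairs-bound (medium k) k 100 283 pointwise ⟩
    100 ^ k * (101 * 283) ^ n          ≤⟨ *-monoʳ-≤ (100 ^ k) (^-monoˡ-≤ n (≤ᵇ⇒≤ (101 * 283) (299 * 100) _)) ⟩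
    100 ^ k * (299 * 100) ^ n          ≡⟨ cong (100 ^ k *_) (^-distribʳ-* 299 100 n) ⟩
    100 ^ k * (299 ^ n * 100 ^ n)      ≡⟨ *-assoc (100 ^ k) (299 ^ n) (100 ^ n) ⟨
    100 ^ k * 299 ^ n * 100 ^ n        ∎)
    where
    open ≤-Reasoning
    P = ∑ λ A → medium k A * pairs L A
    pairs-≥2 : ∀ A → 2 ≤ ∣ A ∣ → pairs L A * 100 ^ n ≤ 283 ^ n
    pairs-≥2 A 2≤∣A∣ with shrink 2 A 2≤∣A∣
    -- Two elements suffice: `pairs-^` with `c = 2` has the base `2 ^ 3 = 8`, and enlarging the set
    -- does not increase `pairs`.
    ... | A₀ , A₀⊆A , size = root-bound 2 {pairs L A} 8 100 283 n
      (≤-trans (^-monoˡ-≤ 2 (pairs-mono A₀⊆A)) (pairs-^ L A₀ 2 size)) (≤ᵇ⇒≤ (8 * 100 ^ 2) (283 ^ 2) _)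
    pointwise : ∀ A → medium k A * pairs L A * 100 ^ n ≤ ⟦ ∣ A ∣ ≤ᵇ k ⟧ * 283 ^ n
    pointwise A with ∣ A ∣ ≤ᵇ 1 in ∣A∣>1 | ∣ A ∣ ≤ᵇ k
    ... | true  | _     = z≤n
    ... | false | false = z≤n
    ... | false | true  = subst₂ _≤_ (cong (_* 100 ^ n) (sym (*-identityˡ (pairs L A)))) (sym (*-identityˡ (283 ^ n)))
      (pairs-≥2 A (≤ᵇ-false ∣ A ∣ 1 ∣A∣>1))

  -- A decidable stand-in for the projection of the bulk triples to (A, B).
  rich : ℕ → Subset n → Subset n → ℕ
  rich k A B = 1 ⊓ ∑ λ C → ⟦ ∣ C ∣ ≡ᵇ k ⟧ * χ L A B C

  rich≤1 : ∀ k A B → rich k A B ≤ 1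
  rich≤1 k A B = m⊓n≤m 1 (∑ λ C → ⟦ ∣ C ∣ ≡ᵇ k ⟧ * χ L A B C)

  -- If `C` is large and the triple avoids, then a subset of `C` with exactly `k` elements also
  -- avoids, and it supplies a term 1 in the sum inside `rich`.
  large-χ≤rich : ∀ k A B C → large k C * χ L A B C ≤ rich k A B
  large-χ≤rich k A B C = bound (∣ C ∣ ≤ᵇ k) refl
    where
    bound : ∀ b → (∣ C ∣ ≤ᵇ k) ≡ b → ⟦ not b ⟧ * χ L A B C ≤ rich k A B
    bound true  _ = z≤n
    bound false ∣C∣>k with shrink k C (<⇒≤ (≤ᵇ-false ∣ C ∣ k ∣C∣>k))
    ... | C₀ , C₀⊆C , size = ⊓-glb
      (≤-trans (≤-reflexive (*-identityˡ (χ L A B C))) (⟦⟧≤1 _))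
      (≤-trans (*-mono-≤ (≤-reflexive (sym size≡ᵇ)) (χ-mono L (⊆-refl {x = A}) (⊆-refl {x = B}) C₀⊆C))
        (≤-∑ (λ C → ⟦ ∣ C ∣ ≡ᵇ k ⟧ * χ L A B C) C₀))
      where
      size≡ᵇ : ⟦ ∣ C₀ ∣ ≡ᵇ k ⟧ ≡ 1
      size≡ᵇ = cong ⟦_⟧ (Equivalence.to T-≡ (≡⇒≡ᵇ ∣ C₀ ∣ k size))

module _ (k : ℕ) .{{_ : NonZero k}} (k-large : 2 ^ suc k * 20 ^ k ≤ 41 ^ k) {n : ℕ} where

  -- The hypothesis `k-large` says that `2 ^ ((k + 1) / k)` is at most `41 / 20`, which bounds each
  -- `pairs L C` by `(41 / 20) ^ n`. The other constants are `4141 = 101 * 41` and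
  -- `2000 = 20 * 100`.
  ∑-exact-pairs : ∀ (L : LatinSquare n) → ∑ (λ C → ⟦ ∣ C ∣ ≡ᵇ k ⟧ * pairs L C) * 2000 ^ n ≤ 100 ^ k * 4141 ^ n
  ∑-exact-pairs L = ∑-pairs-bound L (λ C → ⟦ ∣ C ∣ ≡ᵇ k ⟧) k 20 41 pointwise
    where
    pointwise : ∀ C → ⟦ ∣ C ∣ ≡ᵇ k ⟧ * pairs L C * 20 ^ n ≤ ⟦ ∣ C ∣ ≤ᵇ k ⟧ * 41 ^ n
    pointwise C with ∣ C ∣ ≡ᵇ k in size
    ... | false = z≤n
    ... | true  = ≤-trans (≤-reflexive (*-assoc 1 (pairs L C) (20 ^ n)))
      (*-mono-≤ (≤-reflexive (sym (cong ⟦_⟧ (Equivalence.to T-≡ (≤⇒≤ᵇ (≤-reflexive ∣C∣≡k))))))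
        (root-bound k {pairs L C} (2 ^ suc k) 20 41 n (pairs-^ L C k ∣C∣≡k) k-large))
      where
      ∣C∣≡k : ∣ C ∣ ≡ k
      ∣C∣≡k = ≡ᵇ⇒≡ ∣ C ∣ k (subst T (sym size) _)

  -- Without the minimum this counts avoiding triples whose third set has size `k`; summing over
  -- that set last reduces it to `∑-exact-pairs`.
  ∑-rich : ∀ (L : LatinSquare n) → ∑ (λ A → ∑ λ B → rich L k A B) * 2000 ^ n ≤ 100 ^ k * 4141 ^ n
  ∑-rich L = begin
    ∑ (λ A → ∑ λ B → rich L k A B) * 2000 ^ n                ≤⟨ *-monoˡ-≤ (2000 ^ n) (∑-mono-≤ λ A → ∑-mono-≤ λ B → m⊓n≤n 1 (∑ λ C → ⟦ ∣ C ∣ ≡ᵇ k ⟧ * χ L A B C)) ⟩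
    ∑³ (λ A B C → ⟦ ∣ C ∣ ≡ᵇ k ⟧ * χ L A B C) * 2000 ^ n     ≡⟨ cong (_* 2000 ^ n) (∑³-third L (λ C → ⟦ ∣ C ∣ ≡ᵇ k ⟧)) ⟩
    ∑ (λ C → ⟦ ∣ C ∣ ≡ᵇ k ⟧ * pairs (rotate (rotate L)) C) * 2000 ^ n   ≤⟨ ∑-exact-pairs (rotate (rotate L)) ⟩
    100 ^ k * 4141 ^ n                                       ∎
    where open ≤-Reasoning

-- Main term and error terms.

module _ {n : ℕ} (L : LatinSquare n) where

  ∑³-weights : ∀ (w : Subset n → ℕ) → ∑³ (λ A B C → (w A + w B + w C) * χ L A B C) ≡
    ∑ (λ A → w A * pairs L A) + ∑ (λ B → w B * pairs (rotate L) B) + ∑ (λ C → w C * pairs (rotate (rotate L)) C)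
  ∑³-weights w = begin
    ∑³ (λ A B C → (w A + w B + w C) * χ L A B C)
      ≡⟨ ∑³-cong (λ A B C → lemma (w A) (w B) (w C) (χ L A B C)) ⟩
    ∑³ (λ A B C → w A * χ L A B C + w B * χ L A B C + w C * χ L A B C)
      ≡⟨ ∑³-distrib-+ (λ A B C → w A * χ L A B C + w B * χ L A B C) (λ A B C → w C * χ L A B C) ⟩
    ∑³ (λ A B C → w A * χ L A B C + w B * χ L A B C) + ∑³ (λ A B C → w C * χ L A B C)
      ≡⟨ cong (_+ ∑³ (λ A B C → w C * χ L A B C)) (∑³-distrib-+ (λ A B C → w A * χ L A B C) (λ A B C → w B * χ L A B C)) ⟩
    ∑³ (λ A B C → w A * χ L A B C) + ∑³ (λ A B C → w B * χ L A B C) + ∑³ (λ A B C → w C * χ L A B C)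
      ≡⟨ cong₂ _+_ (cong₂ _+_ (∑³-first L w) (∑³-second L w)) (∑³-third L w) ⟩
    ∑ (λ A → w A * pairs L A) + ∑ (λ B → w B * pairs (rotate L) B) + ∑ (λ C → w C * pairs (rotate (rotate L)) C)  ∎
    where
    open ≡-Reasoning
    lemma : ∀ a b c x → (a + b + c) * x ≡ a * x + b * x + c * x
    lemma = solve-∀

  triples main overlaps : ℕ
  triples = ∑³ (χ L)
  main    = 3 * 4 ^ n + 3 * n * 3 ^ n
  overlaps = ∑³ {n} λ A B C → small A * small B + small B * small C + small C * small A

  -- In `bulk` the indicator is repeated, which keeps its value, so that each factor is bounded by
  -- `rich` for one of the three projections.
  middle bulk : ℕ → ℕ
  middle k = ∑³ λ A B C → (medium k A + medium k B + medium k C) * χ L A B C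
  bulk k = ∑³ λ A B C → large k C * χ L A B C * (large k A * χ L A B C * (large k B * χ L A B C))

  ∑³-small : ∑³ (λ A B C → (small A + small B + small C) * χ L A B C) ≡ main
  ∑³-small = trans (∑³-weights small)
    (trans (cong₂ _+_ (cong₂ _+_ (∑-small-pairs L) (∑-small-pairs (rotate L))) (∑-small-pairs (rotate (rotate L))))
      (lemma (4 ^ n) n (3 ^ n)))
    where
    lemma : ∀ f n t → f + n * t + (f + n * t) + (f + n * t) ≡ 3 * f + 3 * n * t
    lemma = solve-∀

  -- Every set is small, medium or large, so an avoiding triple has a small or medium set or
  -- consists of three large ones.
  triples≤ : ∀ k → triples ≤ main + (middle k + bulk k)
  triples≤ k = begin
    ∑³ (χ L)                                         ≤⟨ ∑³-mono-≤ (λ A B C → pointwise A B C) ⟩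
    ∑³ (λ A B C → f A B C + (g A B C + h A B C))     ≡⟨ ∑³-distrib-+ f (λ A B C → g A B C + h A B C) ⟩
    ∑³ f + ∑³ (λ A B C → g A B C + h A B C)          ≡⟨ cong₂ _+_ ∑³-small (∑³-distrib-+ g h) ⟩
    main + (middle k + bulk k)                       ∎
    where
    open ≤-Reasoning
    f g h : Subset n → Subset n → Subset n → ℕ
    f A B C = (small A + small B + small C) * χ L A B C
    g A B C = (medium k A + medium k B + medium k C) * χ L A B C
    h A B C = large k C * χ L A B C * (large k A * χ L A B C * (large k B * χ L A B C))
    sized : ∀ A → 1 ≤ small A + medium k A + large k A
    sized A = cover (∣ A ∣ ≤ᵇ 1) (∣ A ∣ ≤ᵇ k)
      where
      cover : ∀ p q → 1 ≤ ⟦ p ⟧ + ⟦ not p ∧ q ⟧ + ⟦ not q ⟧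
      cover true  q     = s≤s z≤n
      cover false true  = s≤s z≤n
      cover false false = s≤s z≤n
    split : ∀ {u₁ u₂ u₃ l₁ l₂ l₃} b → 1 ≤ u₁ + l₁ → 1 ≤ u₂ + l₂ → 1 ≤ u₃ + l₃ →
      ⟦ b ⟧ ≤ (u₁ + u₂ + u₃) * ⟦ b ⟧ + l₃ * ⟦ b ⟧ * (l₁ * ⟦ b ⟧ * (l₂ * ⟦ b ⟧))
    split false _ _ _ = z≤n
    split {suc _} true _ _ _ = s≤s z≤n
    split {zero} {suc _} true _ _ _ = s≤s z≤n
    split {zero} {zero} {suc _} true _ _ _ = s≤s z≤n
    split {zero} {zero} {zero} true 1≤l₁ 1≤l₂ 1≤l₃ =
      *-mono-≤ (*-monoˡ-≤ 1 1≤l₃) (*-mono-≤ (*-monoˡ-≤ 1 1≤l₁) (*-monoˡ-≤ 1 1≤l₂))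
    lemma : ∀ s₁ s₂ s₃ m₁ m₂ m₃ x h → ((s₁ + m₁) + (s₂ + m₂) + (s₃ + m₃)) * x + h ≡
      (s₁ + s₂ + s₃) * x + ((m₁ + m₂ + m₃) * x + h)
    lemma = solve-∀
    pointwise : ∀ A B C → χ L A B C ≤ f A B C + (g A B C + h A B C)
    pointwise A B C = ≤-trans (split {small A + medium k A} {small B + medium k B} {small C + medium k C} {large k A} {large k B} {large k C} _ (sized A) (sized B) (sized C))
      (≤-reflexive (lemma (small A) (small B) (small C) (medium k A) (medium k B) (medium k C) (χ L A B C) (h A B C)))

  -- An avoiding triple with `s` small sets is counted `s` times in `main`, and
  -- `s ≤ 1 + s(s - 1)/2`. The last summand counts pairs of small sets; `overlaps` takes it over all
  -- triples, avoiding or not, so that the sum factorises.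
  main≤ : main ≤ triples + overlaps
  main≤ = begin
    main                                                              ≡⟨ ∑³-small ⟨
    ∑³ (λ A B C → (small A + small B + small C) * χ L A B C)          ≤⟨ ∑³-mono-≤ {n} (λ A B C → pointwise (∣ A ∣ ≤ᵇ 1) (∣ B ∣ ≤ᵇ 1) (∣ C ∣ ≤ᵇ 1) (does (avoids? L A B C))) ⟩
    ∑³ (λ A B C → χ L A B C + (small A * small B + small B * small C + small C * small A))
      ≡⟨ ∑³-distrib-+ (χ L) (λ A B C → small A * small B + small B * small C + small C * small A) ⟩
    triples + overlaps                                                 ∎
    where
    open ≤-Reasoning
    pointwise : ∀ a b c d →
      (⟦ a ⟧ + ⟦ b ⟧ + ⟦ c ⟧) * ⟦ d ⟧ ≤ ⟦ d ⟧ + (⟦ a ⟧ * ⟦ b ⟧ + ⟦ b ⟧ * ⟦ c ⟧ + ⟦ c ⟧ * ⟦ a ⟧)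
    pointwise a     b     c     false = ≤-trans (≤-reflexive (*-zeroʳ (⟦ a ⟧ + ⟦ b ⟧ + ⟦ c ⟧))) z≤n
    pointwise true  true  true  true  = ≤ᵇ⇒≤ 3 4 _
    pointwise true  true  false true  = ≤ᵇ⇒≤ 2 2 _
    pointwise true  false true  true  = ≤ᵇ⇒≤ 2 2 _
    pointwise false true  true  true  = ≤ᵇ⇒≤ 2 2 _
    pointwise true  false false true  = ≤ᵇ⇒≤ 1 1 _
    pointwise false true  false true  = ≤ᵇ⇒≤ 1 1 _
    pointwise false false true  true  = ≤ᵇ⇒≤ 1 1 _
    pointwise false false false true  = z≤n

  middle-bound : ∀ k → middle k * 100 ^ n ≤ 3 * 100 ^ k * 299 ^ n
  middle-bound k = begin
    middle k * 100 ^ n                                    ≡⟨ cong (_* 100 ^ n) (∑³-weights (medium k)) ⟩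
    (m₁ + m₂ + m₃) * 100 ^ n                              ≡⟨ lemma₁ m₁ m₂ m₃ (100 ^ n) ⟩
    m₁ * 100 ^ n + m₂ * 100 ^ n + m₃ * 100 ^ n            ≤⟨ +-mono-≤ (+-mono-≤ (∑-medium-pairs L k) (∑-medium-pairs (rotate L) k)) (∑-medium-pairs (rotate (rotate L)) k) ⟩
    E + E + E                                             ≡⟨ lemma₂ (100 ^ k) (299 ^ n) ⟩
    3 * 100 ^ k * 299 ^ n                                 ∎
    where
    open ≤-Reasoning
    m₁ = ∑ λ A → medium k A * pairs L A
    m₂ = ∑ λ B → medium k B * pairs (rotate L) B
    m₃ = ∑ λ C → medium k C * pairs (rotate (rotate L)) C
    E = 100 ^ k * 299 ^ n
    lemma₁ : ∀ a b c x → (a + b + c) * x ≡ a * x + b * x + c * x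
    lemma₁ = solve-∀
    lemma₂ : ∀ q x → q * x + q * x + q * x ≡ 3 * q * x
    lemma₂ = solve-∀

  -- Two small sets leave `2 ^ n` choices for the third, so the base is `1.01² · 2 = 2.0402`, below
  -- 2.99. The constant is `30000 = 3 * 100 * 100`.
  overlaps-bound : overlaps * 100 ^ n ≤ 30000 * 299 ^ n
  overlaps-bound = *-cancelʳ-≤ _ _ (100 ^ n) {{m^n≢0 100 n}} (begin
    overlaps * 100 ^ n * 100 ^ n                    ≡⟨ cong (λ z → z * 100 ^ n * 100 ^ n) overlaps≡ ⟩
    P * 100 ^ n * 100 ^ n                          ≡⟨ lemma₂ s (2 ^ n) (100 ^ n) ⟩
    3 * ((s * 100 ^ n) * (s * 100 ^ n) * 2 ^ n)    ≤⟨ *-monoʳ-≤ 3 (*-monoˡ-≤ (2 ^ n) (*-mono-≤ (∑-size-tail n 1 100) (∑-size-tail n 1 100))) ⟩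
    3 * ((100 * 101 ^ n) * (100 * 101 ^ n) * 2 ^ n)   ≡⟨ lemma₃ (101 ^ n) (2 ^ n) ⟩
    30000 * (101 ^ n * (101 ^ n * 2 ^ n))          ≡⟨ cong (λ z → 30000 * (101 ^ n * z)) (^-distribʳ-* 101 2 n) ⟨
    30000 * (101 ^ n * 202 ^ n)                    ≡⟨ cong (30000 *_) (^-distribʳ-* 101 202 n) ⟨
    30000 * 20402 ^ n                              ≤⟨ *-monoʳ-≤ 30000 (^-monoˡ-≤ n (≤ᵇ⇒≤ 20402 29900 _)) ⟩
    30000 * 29900 ^ n                              ≡⟨ cong (30000 *_) (^-distribʳ-* 299 100 n) ⟩
    30000 * (299 ^ n * 100 ^ n)                    ≡⟨ *-assoc 30000 (299 ^ n) (100 ^ n) ⟨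
    30000 * 299 ^ n * 100 ^ n                      ∎)
    where
    open ≤-Reasoning
    s = ∑ {n} small
    P = s * s * 2 ^ n + s * s * 2 ^ n + s * s * 2 ^ n
    f₁ f₂ f₃ : Subset n → Subset n → Subset n → ℕ
    f₁ A B C = small A * small B
    f₂ A B C = small B * small C
    f₃ A B C = small C * small A
    ∑f₁ : ∑³ f₁ ≡ s * s * 2 ^ n
    ∑f₁ = begin-equality
      ∑³ f₁                                     ≡⟨ ∑³-cong (λ A B C → sym (*-identityʳ (f₁ A B C))) ⟩
      ∑³ (λ A B C → f₁ A B C * 1)               ≡⟨ ∑-cong {n} (λ A → ∑-cong {n} (λ B → ∑-distribˡ-* {n} (small A * small B) (λ _ → 1))) ⟩
      ∑ {n} (λ A → ∑ {n} λ B → small A * small B * ∑ {n} (λ _ → 1))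
        ≡⟨ ∑-cong {n} (λ A → ∑-distribʳ-* {n} (λ B → small A * small B) (∑ {n} (λ _ → 1))) ⟩
      ∑ {n} (λ A → (∑ {n} λ B → small A * small B) * ∑ {n} (λ _ → 1))
        ≡⟨ ∑-distribʳ-* {n} (λ A → ∑ {n} λ B → small A * small B) (∑ {n} (λ _ → 1)) ⟩
      ∑ {n} (λ A → ∑ {n} λ B → small A * small B) * ∑ {n} (λ _ → 1)
        ≡⟨ cong₂ _*_ (∑∑-* {n} {n} small small) (∑-one n) ⟩
      s * s * 2 ^ n                             ∎
    ∑f₃ : ∑³ f₃ ≡ s * s * 2 ^ n
    ∑f₃ = trans (∑³-rotate f₃) (trans (∑³-rotate (λ B C A → f₃ A B C)) ∑f₁)
    ∑f₂ : ∑³ f₂ ≡ s * s * 2 ^ n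
    ∑f₂ = trans (∑³-rotate f₂) ∑f₁
    overlaps≡ : overlaps ≡ P
    overlaps≡ = trans (∑³-distrib-+ (λ A B C → f₁ A B C + f₂ A B C) f₃)
      (cong₂ _+_ (trans (∑³-distrib-+ f₁ f₂) (cong₂ _+_ ∑f₁ ∑f₂)) ∑f₃)
    lemma₂ : ∀ s t h → (s * s * t + s * s * t + s * s * t) * h * h ≡ 3 * ((s * h) * (s * h) * t)
    lemma₂ = solve-∀
    lemma₃ : ∀ u t → 3 * ((100 * u) * (100 * u) * t) ≡ 30000 * (u * (u * t))
    lemma₃ = solve-∀

  -- Loomis–Whitney, multiplied by 800000 ^ n, where 100² · 800000 = 2000³.
  bulk-bound : ∀ k .{{_ : NonZero k}} → 2 ^ suc k * 20 ^ k ≤ 41 ^ k →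
    bulk k * 100 ^ n ≤ 100 ^ k * 100 ^ k * 299 ^ n
  bulk-bound k k-large = ^-cancelˡ-≤ 2 (*-cancelʳ-≤ _ _ (800000 ^ n) {{m^n≢0 800000 n}} (begin
    (S * 100 ^ n) ^ 2 * 800000 ^ n                    ≡⟨ lemma₁ S (100 ^ n) (800000 ^ n) ⟩
    S ^ 2 * (100 ^ n * (100 ^ n * 800000 ^ n))        ≡⟨ cong (S ^ 2 *_) (trans (merge 100 100 800000) (sym (merge 2000 2000 2000))) ⟩
    S ^ 2 * (2000 ^ n * (2000 ^ n * 2000 ^ n))        ≤⟨ *-monoˡ-≤ _ S²≤ ⟩
    F * (G * H) * (2000 ^ n * (2000 ^ n * 2000 ^ n))  ≡⟨ lemma₂ F G H (2000 ^ n) ⟩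
    F * 2000 ^ n * (G * 2000 ^ n * (H * 2000 ^ n))    ≤⟨ *-mono-≤ (∑-rich k k-large L) (*-mono-≤ (∑-rich k k-large (rotate L)) (∑-rich k k-large (rotate (rotate L)))) ⟩
    Q * 4141 ^ n * (Q * 4141 ^ n * (Q * 4141 ^ n))    ≡⟨ lemma₃ Q (4141 ^ n) ⟩
    Q * Q * Q * (4141 ^ n * (4141 ^ n * 4141 ^ n))    ≡⟨ cong (Q * Q * Q *_) (merge 4141 4141 4141) ⟩
    -- One more factor `Q` makes the coefficient a square. The bases compare as
    -- `(1.01 · 2.05)³ < 2.99²`.
    Q * Q * Q * (4141 * (4141 * 4141)) ^ n            ≤⟨ *-mono-≤ (m≤m*n (Q * Q * Q) Q {{m^n≢0 100 k}}) (^-monoˡ-≤ n (≤ᵇ⇒≤ (4141 * (4141 * 4141)) (299 * (299 * 800000)) _)) ⟩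
    Q * Q * Q * Q * (299 * (299 * 800000)) ^ n        ≡⟨ cong (Q * Q * Q * Q *_) (merge 299 299 800000) ⟨
    Q * Q * Q * Q * (299 ^ n * (299 ^ n * 800000 ^ n))   ≡⟨ lemma₄ Q (299 ^ n) (800000 ^ n) ⟩
    (Q * Q * 299 ^ n) ^ 2 * 800000 ^ n                ∎))
    where
    open ≤-Reasoning
    S = bulk k
    Q = 100 ^ k
    F = ∑ λ A → ∑ λ B → rich L k A B
    G = ∑ λ B → ∑ λ C → rich (rotate L) k B C
    H = ∑ λ C → ∑ λ A → rich (rotate (rotate L)) k C A
    merge : ∀ a b c → a ^ n * (b ^ n * c ^ n) ≡ (a * (b * c)) ^ n
    merge a b c = sym (trans (^-distribʳ-* a (b * c) n) (cong (a ^ n *_) (^-distribʳ-* b c n)))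
    S²≤ : S ^ 2 ≤ F * (G * H)
    -- The factors carrying `large k A` and `large k B` are moved to the rotated squares, where that
    -- set comes third.
    S²≤ = ≤-trans (^-monoˡ-≤ 2 (∑³-mono-≤ λ A B C → *-mono-≤ (large-χ≤rich L k A B C)
        (*-mono-≤ (subst (λ x → large k A * x ≤ rich (rotate L) k B C) (sym (χ-rotate L A B C)) (large-χ≤rich (rotate L) k B C A))
                  (subst (λ x → large k B * x ≤ rich (rotate (rotate L)) k C A) (sym (trans (χ-rotate L A B C) (χ-rotate (rotate L) B C A)))
                    (large-χ≤rich (rotate (rotate L)) k C A B)))))
      (loomis-whitney (rich L k) (rich (rotate L) k) (rich (rotate (rotate L)) k)
        (rich≤1 L k) (rich≤1 (rotate L) k) (rich≤1 (rotate (rotate L)) k))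
    lemma₁ : ∀ s x y → (s * x) * ((s * x) * 1) * y ≡ s * (s * 1) * (x * (x * y))
    lemma₁ = solve-∀
    lemma₂ : ∀ f g h x → f * (g * h) * (x * (x * x)) ≡ f * x * (g * x * (h * x))
    lemma₂ = solve-∀
    lemma₃ : ∀ q x → q * x * (q * x * (q * x)) ≡ q * q * q * (x * (x * x))
    lemma₃ = solve-∀
    lemma₄ : ∀ q x y → q * q * q * q * (x * (x * y)) ≡ (q * q * x) * ((q * q * x) * 1) * y
    lemma₄ = solve-∀

-- From the list of triples in the group to the Latin square.

length-filter : ∀ {a p} {X : Set a} {P : Pred X p} (P? : Decidable P) xs →
  length (filter P? xs) ≡ ∑ᴸ (map (λ x → ⟦ does (P? x) ⟧) xs)
length-filter P? []       = refl
length-filter P? (x ∷ xs) with does (P? x)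
... | true  = cong suc (length-filter P? xs)
... | false = length-filter P? xs

∑ᴸ-cartesianProduct : ∀ {a b} {X : Set a} {Y : Set b} (f : X × Y → ℕ) xs ys →
  ∑ᴸ (map f (cartesianProduct xs ys)) ≡ ∑ᴸ (map (λ x → ∑ᴸ (map (λ y → f (x , y)) ys)) xs)
∑ᴸ-cartesianProduct f []       ys = refl
∑ᴸ-cartesianProduct f (x ∷ xs) ys = begin
  ∑ᴸ (map f (map (x ,_) ys List.++ cartesianProduct xs ys))               ≡⟨ cong ∑ᴸ (map-++ f (map (x ,_) ys) _) ⟩
  ∑ᴸ (map f (map (x ,_) ys) List.++ map f (cartesianProduct xs ys))       ≡⟨ sum-++ (map f (map (x ,_) ys)) _ ⟩
  ∑ᴸ (map f (map (x ,_) ys)) + ∑ᴸ (map f (cartesianProduct xs ys))        ≡⟨ cong₂ _+_ (cong ∑ᴸ (sym (map-∘ ys))) (∑ᴸ-cartesianProduct f xs ys) ⟩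
  ∑ᴸ (map (λ y → f (x , y)) ys) + ∑ᴸ (map (λ x → ∑ᴸ (map (λ y → f (x , y)) ys)) xs)  ∎
  where open ≡-Reasoning

∑ᴸ-allSubsets : ∀ {n} (f : Subset n → ℕ) → ∑ᴸ (map f (allSubsets n)) ≡ ∑ f
∑ᴸ-allSubsets {zero}  f = +-identityʳ (f [])
∑ᴸ-allSubsets {suc n} f = begin
  ∑ᴸ (map f (map (inside ∷_) (allSubsets n) List.++ map (outside ∷_) (allSubsets n)))
    ≡⟨ cong ∑ᴸ (map-++ f (map (inside ∷_) (allSubsets n)) _) ⟩
  ∑ᴸ (map f (map (inside ∷_) (allSubsets n)) List.++ map f (map (outside ∷_) (allSubsets n)))
    ≡⟨ sum-++ (map f (map (inside ∷_) (allSubsets n))) _ ⟩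
  ∑ᴸ (map f (map (inside ∷_) (allSubsets n))) + ∑ᴸ (map f (map (outside ∷_) (allSubsets n)))
    ≡⟨ cong₂ (λ xs ys → ∑ᴸ xs + ∑ᴸ ys) (map-∘ (allSubsets n)) (map-∘ (allSubsets n)) ⟨
  ∑ᴸ (map (f ∘ (inside ∷_)) (allSubsets n)) + ∑ᴸ (map (f ∘ (outside ∷_)) (allSubsets n))
    ≡⟨ cong₂ _+_ (∑ᴸ-allSubsets (f ∘ (inside ∷_))) (∑ᴸ-allSubsets (f ∘ (outside ∷_))) ⟩
  ∑ (f ∘ (inside ∷_)) + ∑ (f ∘ (outside ∷_))
    ≡⟨ +-comm (∑ (f ∘ (inside ∷_))) _ ⟩
  ∑ f  ∎
  where
  open ≡-Reasoning

module _ {a ℓ} (G : AbelianGroup a ℓ) {N : ℕ} (index : HasOrder G N) where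
  open AbelianGroup G using (Carrier; _≈_; _∙_; _⁻¹; ∙-cong; ∙-congʳ; ∙-congˡ; comm; group)
    renaming (sym to ≈-sym; trans to ≈-trans)
  open GroupProperties group
  open Inverse index using (to; from; to-cong; strictlyInverseˡ; strictlyInverseʳ)

  cayley : LatinSquare N
  cayley = record
    { third        = λ i j → to (from i ∙ from j)
    ; first        = λ j k → to (from k ∙ from j ⁻¹)
    ; second       = λ k i → to (from i ⁻¹ ∙ from k)
    ; third⇒first  = λ {i} {j} {k} ij≡k → ≈⇒to≡
        (≈-trans (∙-congʳ (≈-sym (to≡⇒≈ ij≡k))) (//-rightDividesʳ (from j) (from i)))
    ; first⇒second = λ {i} {j} {k} kj≡i → ≈⇒to≡
        (≈-trans (∙-congˡ (≈-trans (≈-sym (//-rightDividesˡ (from j) (from k))) (∙-congʳ (to≡⇒≈ kj≡i))))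
          (\\-leftDividesʳ (from i) (from j)))
    ; second⇒third = λ {i} {j} {k} ik≡j → ≈⇒to≡
        (≈-trans (∙-congˡ (≈-sym (to≡⇒≈ ik≡j))) (\\-leftDividesˡ (from i) (from k)))
    }
    where
    to≡⇒≈ : ∀ {x i} → to x ≡ i → x ≈ from i
    to≡⇒≈ refl = ≈-sym (strictlyInverseʳ _)
    ≈⇒to≡ : ∀ {x i} → x ≈ from i → to x ≡ i
    ≈⇒to≡ x≈i = trans (to-cong x≈i) (strictlyInverseˡ _)

  numSumAvoiding≡triples : numSumAvoiding G index ≡ triples cayley
  numSumAvoiding≡triples = begin
    length (filter avoiding? (cartesianProduct subsets (cartesianProduct subsets subsets)))
      ≡⟨ length-filter avoiding? (cartesianProduct subsets (cartesianProduct subsets subsets)) ⟩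
    ∑ᴸ (map indicator (cartesianProduct subsets (cartesianProduct subsets subsets)))
      ≡⟨ ∑ᴸ-cartesianProduct indicator subsets _ ⟩
    ∑ᴸ (map (λ A → ∑ᴸ (map (λ BC → indicator (A , BC)) (cartesianProduct subsets subsets))) subsets)
      ≡⟨ ∑ᴸ-allSubsets {N} _ ⟩
    ∑ {N} (λ A → ∑ᴸ (map (λ BC → indicator (A , BC)) (cartesianProduct subsets subsets)))
      ≡⟨ ∑-cong {N} (λ A → trans (∑ᴸ-cartesianProduct (λ BC → indicator (A , BC)) subsets subsets)
           (trans (∑ᴸ-allSubsets {N} _) (∑-cong {N} (λ B → ∑ᴸ-allSubsets (λ C → indicator (A , B , C)))))) ⟩
    -- The indicators agree by computation: `sumAvoiding?` wraps the same test on indices as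
    -- `avoids?` for `cayley`, and `map′` keeps the Boolean.
    triples cayley  ∎
    where
    open ≡-Reasoning
    subsets = allSubsets N
    avoiding? = sumAvoiding? G index
    indicator : Subset N × Subset N × Subset N → ℕ
    indicator t = ⟦ does (avoiding? t) ⟧

-- The asymptotic formula in integers.

deviation : ℕ → ℕ → ℤ
deviation n t = + t ℤ.- + (3 * 4 ^ n) ℤ.- + (3 * n * 3 ^ n)

triples-asymptotics : ∃[ K ] (NonZero K × ∀ {n} (L : LatinSquare n) →
  ℤ.∣ deviation n (triples L) ∣ * 100 ^ n ≤ K * 299 ^ n)
triples-asymptotics = constant 32 , constant≢0 32 ,
  -- For `k = 32` the numerical condition says `2 ≤ (41 / 40) ^ 32`.
  λ L → bound 32 (≤ᵇ⇒≤ (2 ^ 33 * 20 ^ 32) (41 ^ 32) _) L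
  where
  open ≤-Reasoning
  constant : ℕ → ℕ
  constant k = 3 * 100 ^ k + 100 ^ k * 100 ^ k + 30000
  constant≢0 : ∀ k → NonZero (constant k)
  constant≢0 k = >-nonZero (≤-trans (≤ᵇ⇒≤ 1 30000 _) (m≤n+m 30000 (3 * 100 ^ k + 100 ^ k * 100 ^ k)))
  pos-minus : ∀ t a b → + t ℤ.- + a ℤ.- + b ≡ t ℤ.⊖ (a + b)
  pos-minus t a b = trans (ℤ.+-assoc (+ t) (ℤ.- + a) (ℤ.- + b))
    (trans (cong (λ z → + t ℤ.+ z) (sym (ℤ.neg-distrib-+ (+ a) (+ b)))) (ℤ.m-n≡m⊖n t (a + b)))
  ∣⊖∣-bound : ∀ {m n r} → m ≤ n + r → n ≤ m + r → ℤ.∣ m ℤ.⊖ n ∣ ≤ r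
  ∣⊖∣-bound {m} {n} m≤n+r n≤m+r with ≤-total m n
  ... | inj₁ m≤n = ≤-trans (≤-reflexive (ℤ.∣⊖∣-≤ m≤n)) (m≤n+o⇒m∸n≤o n m n≤m+r)
  ... | inj₂ n≤m = ≤-trans (≤-reflexive (trans (ℤ.∣m⊖n∣≡∣n⊖m∣ m n) (ℤ.∣⊖∣-≤ n≤m))) (m≤n+o⇒m∸n≤o m n m≤n+r)
  bound : ∀ k .{{_ : NonZero k}} → 2 ^ suc k * 20 ^ k ≤ 41 ^ k → ∀ {n} (L : LatinSquare n) →
    ℤ.∣ deviation n (triples L) ∣ * 100 ^ n ≤ constant k * 299 ^ n
  bound k k-large {n} L = begin
    ℤ.∣ deviation n (triples L) ∣ * 100 ^ n   ≡⟨ cong (λ z → ℤ.∣ z ∣ * 100 ^ n) (pos-minus (triples L) (3 * 4 ^ n) (3 * n * 3 ^ n)) ⟩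
    ℤ.∣ triples L ℤ.⊖ main L ∣ * 100 ^ n                                  ≤⟨ *-monoˡ-≤ (100 ^ n) (∣⊖∣-bound upper lower) ⟩
    (m + b + o) * 100 ^ n                                                 ≡⟨ lemma m b o (100 ^ n) ⟩
    m * 100 ^ n + b * 100 ^ n + o * 100 ^ n                               ≤⟨ +-mono-≤ (+-mono-≤ (middle-bound L k) (bulk-bound L k k-large)) (overlaps-bound L) ⟩
    3 * 100 ^ k * 299 ^ n + 100 ^ k * 100 ^ k * 299 ^ n + 30000 * 299 ^ n   ≡⟨ lemma (3 * 100 ^ k) (100 ^ k * 100 ^ k) 30000 (299 ^ n) ⟨
    constant k * 299 ^ n                                                  ∎
    where
    m = middle L k
    b = bulk L k
    o = overlaps L
    upper : triples L ≤ main L + (m + b + o)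
    upper = ≤-trans (triples≤ L k) (+-monoʳ-≤ (main L) (m≤m+n (m + b) o))
    lower : main L ≤ triples L + (m + b + o)
    lower = ≤-trans (main≤ L) (+-monoʳ-≤ (triples L) (m≤n+m o (m + b)))
    lemma : ∀ a b c x → (a + b + c) * x ≡ a * x + b * x + c * x
    lemma = solve-∀

-- Transfer to the rationals.

-- In lowest terms by construction, whereas `z / 1` goes through a normalisation.
integer : ℤ → ℚ
integer z = mkℚ z 0 (coprime-sym (1-coprimeTo ℤ.∣ z ∣))

/1≡integer : ∀ z → z / 1 ≡ integer z
/1≡integer z = ℚ.↥p/↧p≡p (integer z)

∣z/1∣≡integer : ∀ z → ℚ.∣ z / 1 ∣ ≡ integer (+ ℤ.∣ z ∣)
∣z/1∣≡integer z = cong ℚ.∣_∣ (/1≡integer z)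

integer-* : ∀ m n → integer (+ m) ℚ.* integer (+ n) ≡ integer (+ (m * n))
integer-* m n = trans (cong (_/ 1) (sym (ℤ.pos-* m n))) (/1≡integer (+ (m * n)))

integer-mono-≤ : ∀ {m n} → m ≤ n → integer (+ m) ℚ.≤ integer (+ n)
integer-mono-≤ {m} {n} m≤n = *≤* (subst₂ ℤ._≤_ (sym (ℤ.*-identityʳ (+ m))) (sym (ℤ.*-identityʳ (+ n))) (ℤ.+≤+ m≤n))

σ : ℚ
σ = (+ 3 / 1) ℚ.- (+ 1 / 100)

σ^n*100^n : ∀ n → σ ^ℚ n ℚ.* integer (+ (100 ^ n)) ≡ integer (+ (299 ^ n))
σ^n*100^n zero    = refl
σ^n*100^n (suc n) = begin
  σ ℚ.* σ ^ℚ n ℚ.* integer (+ (100 * 100 ^ n))                            ≡⟨ cong (σ ℚ.* σ ^ℚ n ℚ.*_) (integer-* 100 (100 ^ n)) ⟨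
  σ ℚ.* σ ^ℚ n ℚ.* (integer (+ 100) ℚ.* integer (+ (100 ^ n)))            ≡⟨ interchange σ (σ ^ℚ n) (integer (+ 100)) _ ⟩
  σ ℚ.* integer (+ 100) ℚ.* (σ ^ℚ n ℚ.* integer (+ (100 ^ n)))            ≡⟨ cong (integer (+ 299) ℚ.*_) (σ^n*100^n n) ⟩
  integer (+ 299) ℚ.* integer (+ (299 ^ n))                               ≡⟨ integer-* 299 (299 ^ n) ⟩
  integer (+ (299 * 299 ^ n))                                             ∎
  where
  open ≡-Reasoning
  open CommutativeSemigroupProperties (CommutativeMonoid.commutativeSemigroup ℚ.*-1-commutativeMonoid)
    using (interchange)

integer-pos : ∀ n .{{_ : NonZero n}} → ℚ.Positive (integer (+ n))
integer-pos (suc n) = _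

-- Multiplying by the positive `100 ^ n` turns `σ ^ℚ n` into `299 ^ n`, which leaves the inequality
-- between natural numbers.
∣z/1∣≤K*σ^n : ∀ z K n → ℤ.∣ z ∣ * 100 ^ n ≤ K * 299 ^ n → ℚ.∣ z / 1 ∣ ℚ.≤ (+ K / 1) ℚ.* σ ^ℚ n
∣z/1∣≤K*σ^n z K n z≤ = ℚ.*-cancelʳ-≤-pos (integer (+ (100 ^ n))) {{integer-pos (100 ^ n) {{m^n≢0 100 n}}}} (begin
  ℚ.∣ z / 1 ∣ ℚ.* integer (+ (100 ^ n))                     ≡⟨ cong (ℚ._* integer (+ (100 ^ n))) (∣z/1∣≡integer z) ⟩
  integer (+ ℤ.∣ z ∣) ℚ.* integer (+ (100 ^ n))             ≡⟨ integer-* ℤ.∣ z ∣ (100 ^ n) ⟩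
  integer (+ (ℤ.∣ z ∣ * 100 ^ n))                           ≤⟨ integer-mono-≤ z≤ ⟩
  integer (+ (K * 299 ^ n))                                 ≡⟨ integer-* K (299 ^ n) ⟨
  integer (+ K) ℚ.* integer (+ (299 ^ n))                   ≡⟨ cong (integer (+ K) ℚ.*_) (σ^n*100^n n) ⟨
  integer (+ K) ℚ.* (σ ^ℚ n ℚ.* integer (+ (100 ^ n)))      ≡⟨ ℚ.*-assoc (integer (+ K)) (σ ^ℚ n) _ ⟨
  integer (+ K) ℚ.* σ ^ℚ n ℚ.* integer (+ (100 ^ n))        ≡⟨ cong (λ q → q ℚ.* σ ^ℚ n ℚ.* integer (+ (100 ^ n))) (/1≡integer (+ K)) ⟨
  (+ K / 1) ℚ.* σ ^ℚ n ℚ.* integer (+ (100 ^ n))            ∎)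
  where open ℚ.≤-Reasoning

theorem16 : ∀ {a ℓ} →
    ∃[ c ] ∃[ K ] (0ℚ ℚ.< c × 0ℚ ℚ.< K ×
    (∀ (G : AbelianGroup a ℓ) (N : ℕ) (index : HasOrder G N) →
    ℚ.∣ (+ numSumAvoiding G index ℤ.- + (3 ℕ.* 4 ℕ.^ N) ℤ.- + (3 ℕ.* N ℕ.* 3 ℕ.^ N)) / 1 ∣
    ℚ.≤ K ℚ.* ((+ 3 / 1) ℚ.- c) ^ℚ N))
theorem16 = conclude triples-asymptotics
  where
  conclude : (∃[ K ] (NonZero K × ∀ {n} (L : LatinSquare n) →
    ℤ.∣ deviation n (triples L) ∣ * 100 ^ n ≤ K * 299 ^ n)) → _
  conclude (K , K≢0 , bound) =
    -- The choice `c = 1 / 100` makes `3 - c` equal to `299 / 100`.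
    + 1 / 100 , + K / 1 , ℚ.positive⁻¹ (+ 1 / 100) , ℚ.positive⁻¹ (+ K / 1) {{ℚ.normalize-pos K 1 {{_}} {{K≢0}}}} ,
    λ G N index → ∣z/1∣≤K*σ^n (deviation N (numSumAvoiding G index)) K N
      (subst (λ t → ℤ.∣ deviation N t ∣ * 100 ^ N ≤ K * 299 ^ N)
        (sym (numSumAvoiding≡triples G index)) (bound (cayley G index)))
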